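{- There exists a constant $c$ (independent of $m$) such that the following holds. Let $m\ge 1$ be an integer, put $m_0:=\lfloor m/2\rfloor$, and let $P$ be a digital $(0,m,2)$-net over $\mathbb{Z}_2$ whose generating matrices are \[ C_1=I_{m,m},\qquad C_2=\begin{pmatrix} A & B\\ C & D\end{pmatrix}, \] where $I_{m,m}$ is the $m\times m$ identity matrix over $\mathbb{Z}_2$ and $A$ is a nonsingular $m_0\times m_0$ matrix over $\mathbb{Z}_2$ (and $B$, $C$, $D$ are matrices over $\mathbb{Z}_2$ of the appropriate sizes such that $C_1,C_2$ generate a digital $(0,m,2)$-net). Then \[ D^\ast(P)\ge \frac{m}{12}+c . \]
   Context: Digital nets: for $m\times m$ matrices $C_1,C_2$ over $\mathbb{Z}_2$ and $n\in\{0,\dots,2^m-1\}$ with binary digits $n=n_0+n_1 2+\cdots+n_{m-1}2^{m-1}$, set $C_j(n_0,\dots,n_{m-1})^\top=(y^{(j)}_1(n),\dots,y^{(j)}_m(n))^\top$ and $x_n^{(j)}=\sum_{k=1}^m y^{(j)}_k(n)2^{ -k}$; the multiset $P=\{\boldsymbol{x}_n=(x_n^{(1)},x_n^{(2)}):0\le n<2^m\}$ is the digital net generated by $C_1,C_2$. It is a digital $(0,m,2)$-net over $\mathbb{Z}_2$ if for all nonnegative integers $d_1,d_2$ with $d_1+d_2=m$, the first $d_1$ rows of $C_1$ together with the first $d_2$ rows of $C_2$ are linearly independent over $\mathbb{Z}_2$. Star discrepancy (unnormalized): for a point set $P$ of $N$ points in $[0,1)^2$, $D^\ast(P)=\sup_J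 |A(J,P)-N\lambda(J)|$, the supremum over all intervals $J=[0,\alpha_1)\times[0,\alpha_2)$ with $0<\alpha_1,\alpha_2\le 1$, where $A(J,P)$ is the number of points of $P$ (counted with multiplicity) lying in $J$ and $\lambda$ is Lebesgue measure. -}

module Defs where

open import Data.Bool using (Bool; true; false; _∧_; _xor_; if_then_else_)
open import Data.Nat as ℕ using (ℕ; zero; suc; _≤_; _^_)
open import Data.Nat.DivMod using (_/_; _%_; m/n≤m)
open import Data.Fin using (Fin; toℕ; inject≤)
import Data.Fin as Fin
open import Data.List using (List; []; _∷_; length; map; upTo)
open import Data.Product using (_×_; _,_; ∃-syntax)
open import Data.Rational as ℚ using (ℚ; 0ℚ; 1ℚ; ½; ∣_∣)
open import Data.Integer using (+_)
open import Relation.Binary.PropositionalEquality using (_≡_)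
open import Relation.Nullary using (yes; no)

-- Matrices over ℤ₂ = Bool (addition = xor, multiplication = ∧)

Mat : ℕ → ℕ → Set
Mat r s = Fin r → Fin s → Bool

⊕sum : ∀ {n} → (Fin n → Bool) → Bool
⊕sum {zero}  f = false
⊕sum {suc n} f = f Fin.zero xor ⊕sum (λ i → f (Fin.suc i))

ℚsum : ∀ {n} → (Fin n → ℚ) → ℚ
ℚsum {zero}  f = 0ℚ
ℚsum {suc n} f = f Fin.zero ℚ.+ ℚsum (λ i → f (Fin.suc i))

idMat : (m : ℕ) → Mat m m
idMat m i j with i Fin.≟ j
... | yes _ = true
... | no  _ = false

_·_ : ∀ {r s t} → Mat r s → Mat s t → Mat r t
(M · N) i k = ⊕sum (λ j → M i j ∧ N j k)

Nonsingular : ∀ {k} → Mat k k → Set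
Nonsingular {k} M = ∃[ N ] ((∀ i j → (M · N) i j ≡ idMat k i j)
                          × (∀ i j → (N · M) i j ≡ idMat k i j))

upperLeft : ∀ {m} → Mat m m → Mat (m / 2) (m / 2)
upperLeft {m} M i j = M (inject≤ i (m/n≤m m 2)) (inject≤ j (m/n≤m m 2))

-- for all d₁ + d₂ = m, the first d₁ rows of C₁ together with the first
-- d₂ rows of C₂ are linearly independent over ℤ₂: every ℤ₂-linear
-- combination of these rows that vanishes has all coefficients zero.
IsDigital0m2Net : ∀ {m} → Mat m m → Mat m m → Set
IsDigital0m2Net {m} C₁ C₂ =
  ∀ (d₁ d₂ : ℕ) → d₁ ℕ.+ d₂ ≡ m →
  ∀ (a b : Fin m → Bool) →
  (∀ i → d₁ ≤ toℕ i → a i ≡ false) →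
  (∀ i → d₂ ≤ toℕ i → b i ≡ false) →
  (∀ l → ⊕sum (λ i → (a i ∧ C₁ i l) xor (b i ∧ C₂ i l)) ≡ false) →
  (∀ i → a i ≡ false) × (∀ i → b i ≡ false)

digit : ℕ → ℕ → Bool
digit n zero    = n % 2 ℕ.≡ᵇ 1
digit n (suc i) = digit (n / 2) i

bit→ℚ : Bool → ℚ
bit→ℚ true  = 1ℚ
bit→ℚ false = 0ℚ

half^ : ℕ → ℚ
half^ zero    = 1ℚ
half^ (suc k) = ½ ℚ.* half^ k

-- y^{(j)}_k(n), k = toℕ row + 1
yDigit : ∀ {m} → Mat m m → ℕ → Fin m → Bool
yDigit C n k = ⊕sum (λ i → C k i ∧ digit n (toℕ i))

coord : ∀ {m} → Mat m m → ℕ → ℚ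
coord C n = ℚsum (λ k → bit→ℚ (yDigit C n k) ℚ.* half^ (suc (toℕ k)))

digitalNet : ∀ {m} → Mat m m → Mat m m → List (ℚ × ℚ)
digitalNet {m} C₁ C₂ = map (λ n → coord C₁ n , coord C₂ n) (upTo (2 ^ m))

count : ℚ → ℚ → List (ℚ × ℚ) → ℕ
count α₁ α₂ [] = 0
count α₁ α₂ ((x , y) ∷ ps) with x ℚ.<? α₁ | y ℚ.<? α₂
... | yes _ | yes _ = suc (count α₁ α₂ ps)
... | _     | _     = count α₁ α₂ ps

localDisc : List (ℚ × ℚ) → ℚ → ℚ → ℚ
localDisc P α₁ α₂ =
  ∣ (+ count α₁ α₂ P) ℚ./ 1 ℚ.- ((+ length P) ℚ./ 1) ℚ.* (α₁ ℚ.* α₂) ∣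

-- D*(P) ≥ K, i.e. sup_J |A(J,P) - N λ(J)| ≥ K: for every ε > 0 there is
-- an anchored box J = [0,α₁) × [0,α₂), 0 < αᵢ ≤ 1, with local discrepancy
-- > K - ε.  (The local discrepancy is left-continuous in each αᵢ, so the
-- supremum over real αᵢ equals the supremum over rational αᵢ.)
StarDisc≥ : List (ℚ × ℚ) → ℚ → Set
StarDisc≥ P K =
  ∀ (ε : ℚ) → 0ℚ ℚ.< ε →
  ∃[ α₁ ] ∃[ α₂ ] ((0ℚ ℚ.< α₁) × (α₁ ℚ.≤ 1ℚ) × (0ℚ ℚ.< α₂) × (α₂ ℚ.≤ 1ℚ)
                  × (K ℚ.- ε ℚ.< localDisc P α₁ α₂))

{-# OPTIONS --safe #-}
module Submission where

-- Take boxes [0,α) × [0,2/3), so that the digits of the second side alternate. The digits of α cut [0,α) into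
-- dyadic strips. By the net property, all but one of the 2ᵏ points in the strip of the digit followed by k others
-- are decided by the first k digits of their ordinates, so the strip contributes ±1/3 to the discrepancy, as soon
-- as the undecided point differs from 2/3 in digit k, and the sign is then that of (−1)ᵏ. Since A is nonsingular,
-- the first half of the digits of α can shift the leading digits of the ordinates at will; digit k only matters
-- for one parity. So one common first half works both for the α whose second half has its ones at even k and for
-- the α with the ones at odd k. The discrepancies of these two boxes differ by ⌊m/2⌋/3, hence one of them is at
-- least ⌊m/2⌋/6 ≥ (m − 1)/12 in absolute value.

open import Defs
import Algebra.Properties.CommutativeSemigroup as CommutativeSemigroupProperties
open import Algebra.Bundles using (CommutativeRing)
open import Data.Bool using (Bool; true; false; if_then_else_; _∧_; _xor_; not)
import Data.Bool.Properties as Bool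
open import Data.Fin as Fin using (Fin; toℕ; fromℕ<; _↑ˡ_; _↑ʳ_)
import Data.Fin.Properties as Fin
import Data.Integer as ℤ
import Data.Integer.Properties as ℤ
open import Data.List as List using (map; upTo; applyUpTo)
import Data.List.Properties as List
open import Data.Nat as ℕ using (ℕ; zero; suc; s≤s; z<s; s<s; s<s⁻¹)
open import Data.Nat.DivMod using (_%_)
import Data.Nat.DivMod as ℕ
open import Data.Nat.Divisibility using (n∣m*n)
import Data.Nat.Properties as ℕ
import Data.Nat.Solver
open import Data.Product using (∃-syntax; _×_; _,_; proj₁; proj₂)
import Data.Rational.Properties as ℚ
import Data.Rational.Solver
import Data.Rational.Unnormalised as ℚᵘ
import Data.Rational.Unnormalised.Properties as ℚᵘ
open import Data.Sum using (_⊎_; inj₁; inj₂; [_,_]′)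
open import Data.Unit using (⊤; tt)
open import Data.Vec using (Vec; []; _∷_; _++_; replicate; lookup; tabulate)
import Data.Vec.Properties as Vec
open import Function using (_∘_; id; Inverse; mk⇔)
open import Relation.Binary.PropositionalEquality
open import Relation.Nullary using (Dec; yes; no; does; contradiction)
open import Relation.Nullary.Decidable using (does-⇔; dec-true; dec-false; from-yes)
open import Relation.Nullary.Reflects using (Reflects; ofʸ; ofⁿ)

-- Digits, dyadic strips and their counts, entirely in natural numbers and bits.

module DigitalStrips where

  open import Data.Nat using (_+_; _*_; _^_; _≤_; _<_)
  open Data.Nat.Solver using (module +-*-Solver)
  open CommutativeSemigroupProperties (CommutativeRing.+-commutativeSemigroup Bool.xor-∧-commutativeRing)
    using (interchange)

  -- Sums over Boolean vectors

  sumV : ∀ {n} → (Vec Bool n → ℕ) → ℕ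
  sumV {zero}  f = f []
  sumV {suc n} f = sumV (f ∘ (false ∷_)) + sumV (f ∘ (true ∷_))

  sumV-cong : ∀ {n} {f g : Vec Bool n → ℕ} → f ≗ g → sumV f ≡ sumV g
  sumV-cong {zero}  f≗g = f≗g []
  sumV-cong {suc n} f≗g = cong₂ _+_ (sumV-cong (f≗g ∘ (false ∷_))) (sumV-cong (f≗g ∘ (true ∷_)))

  sumV-const : ∀ n c → sumV {n} (λ _ → c) ≡ 2 ^ n * c
  sumV-const zero    c = sym (ℕ.*-identityˡ c)
  sumV-const (suc n) c = begin
    sumV {n} (λ _ → c) + sumV {n} (λ _ → c)  ≡⟨ cong (λ s → s + s) (sumV-const n c) ⟩
    2 ^ n * c + 2 ^ n * c                    ≡⟨ solve 2 (λ p c → p :* c :+ p :* c := (con 2 :* p) :* c) refl (2 ^ n) c ⟩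
    2 ^ suc n * c                            ∎
    where
    open ≡-Reasoning
    open +-*-Solver

  sumV-0 : ∀ n → sumV {n} (λ _ → 0) ≡ 0
  sumV-0 n = trans (sumV-const n 0) (ℕ.*-zeroʳ (2 ^ n))

  sumV-+ : ∀ {n} (f g : Vec Bool n → ℕ) → sumV (λ u → f u + g u) ≡ sumV f + sumV g
  sumV-+ {zero}  f g = refl
  sumV-+ {suc n} f g = trans
    (cong₂ _+_ (sumV-+ (f ∘ (false ∷_)) (g ∘ (false ∷_))) (sumV-+ (f ∘ (true ∷_)) (g ∘ (true ∷_))))
    (solve 4 (λ a b c d → (a :+ b) :+ (c :+ d) := (a :+ c) :+ (b :+ d)) refl
      (sumV (f ∘ (false ∷_))) (sumV (g ∘ (false ∷_))) (sumV (f ∘ (true ∷_))) (sumV (g ∘ (true ∷_))))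
    where
    open +-*-Solver

  sumV-swap : ∀ {m n} (f : Vec Bool m → Vec Bool n → ℕ) →
              sumV (λ u → sumV (f u)) ≡ sumV (λ w → sumV (λ u → f u w))
  sumV-swap {zero}  f = refl
  sumV-swap {suc m} f = trans
    (cong₂ _+_ (sumV-swap (f ∘ (false ∷_))) (sumV-swap (f ∘ (true ∷_))))
    (sym (sumV-+ (λ w → sumV (λ u → f (false ∷ u) w)) (λ w → sumV (λ u → f (true ∷ u) w))))

  _≟ᵛ_ : ∀ {n} (u w : Vec Bool n) → Dec (u ≡ w)
  _≟ᵛ_ = Vec.≡-dec Bool._≟_

  δ : ∀ {n} → Vec Bool n → Vec Bool n → ℕ
  δ u w = if does (u ≟ᵛ w) then 1 else 0

  sumV-δ : ∀ {n} (w : Vec Bool n) (f : Vec Bool n → ℕ) → sumV (λ u → δ u w * f u) ≡ f w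
  sumV-δ []          f = ℕ.*-identityˡ (f [])
  sumV-δ {suc n} (false ∷ w) f =
    trans (cong₂ _+_ (sumV-δ w (f ∘ (false ∷_))) (sumV-0 n)) (ℕ.+-identityʳ _)
  sumV-δ {suc n} (true ∷ w)  f =
    cong₂ _+_ (sumV-0 n) (sumV-δ w (f ∘ (true ∷_)))

  -- Insert a delta at `h z`, exchange the two sums, move `h` across the delta as `h⁻¹`, and let the
  -- delta collapse the inner sum.
  sumV-reindex : ∀ {n} (h h⁻¹ : Vec Bool n → Vec Bool n) →
                 (∀ u → h (h⁻¹ u) ≡ u) → (∀ z → h⁻¹ (h z) ≡ z) →
                 (f : Vec Bool n → ℕ) → sumV f ≡ sumV (f ∘ h⁻¹)
  sumV-reindex h h⁻¹ hh⁻¹ h⁻¹h f = begin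
    sumV f                                       ≡⟨ sumV-cong (λ z → sym (sumV-δ (h z) (λ _ → f z))) ⟩
    sumV (λ z → sumV (λ u → δ u (h z) * f z))    ≡⟨ sumV-swap (λ z u → δ u (h z) * f z) ⟩
    sumV (λ u → sumV (λ z → δ u (h z) * f z))    ≡⟨ sumV-cong (λ u → sumV-cong (λ z → cong (_* f z) (δ-adjoint u z))) ⟩
    sumV (λ u → sumV (λ z → δ z (h⁻¹ u) * f z))  ≡⟨ sumV-cong (λ u → sumV-δ (h⁻¹ u) f) ⟩
    sumV (f ∘ h⁻¹)                               ∎
    where
    open ≡-Reasoning
    δ-adjoint : ∀ u z → δ u (h z) ≡ δ z (h⁻¹ u)
    δ-adjoint u z = cong (if_then 1 else 0)
      (does-⇔ (mk⇔ (λ u≡hz → sym (trans (cong h⁻¹ u≡hz) (h⁻¹h z)))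
                   (λ z≡h⁻¹u → sym (trans (cong h z≡h⁻¹u) (hh⁻¹ u)))) (u ≟ᵛ h z) (z ≟ᵛ h⁻¹ u))

  -- Injective self-maps of a finite cube are onto

  Injective : {A B : Set} → (A → B) → Set
  Injective f = ∀ {x y} → f x ≡ f y → x ≡ y

  private
    module 2↔Bool = Inverse Fin.2↔Bool

  encode : ∀ {n} → Vec Bool n → Fin (2 ^ n)
  encode []      = Fin.zero
  encode (b ∷ v) = Fin.combine (2↔Bool.from b) (encode v)

  decode : ∀ n → Fin (2 ^ n) → Vec Bool n
  decode zero    _ = []
  decode (suc n) i = 2↔Bool.to (Fin.quotient (2 ^ n) i) ∷ decode n (Fin.remainder {2} (2 ^ n) i)

  encode-injective : ∀ {n} → Injective (encode {n})
  encode-injective {x = []}    {[]}    _  = refl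
  encode-injective {x = b ∷ u} {c ∷ w} eq = cong₂ _∷_
    (trans (sym (2↔Bool.strictlyInverseˡ b)) (trans (cong 2↔Bool.to (proj₁ eqs)) (2↔Bool.strictlyInverseˡ c)))
    (encode-injective (proj₂ eqs))
    where eqs = Fin.combine-injective _ (encode u) _ (encode w) eq

  encode-decode : ∀ n i → encode (decode n i) ≡ i
  encode-decode zero    Fin.zero = refl
  encode-decode (suc n) i = trans
    (cong₂ Fin.combine (2↔Bool.strictlyInverseʳ (Fin.quotient (2 ^ n) i)) (encode-decode n _))
    (Fin.combine-remQuot {2} (2 ^ n) i)

  -- Pigeonhole with `u` as an extra pigeon beside the `2 ^ n` values of `h`. A collision between
  -- two values of `h` contradicts injectivity, so some collision involves `u` and yields its
  -- preimage.
  injective⇒surjective : ∀ {n} (h : Vec Bool n → Vec Bool n) → Injective h → ∀ u → ∃[ z ] h z ≡ u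
  injective⇒surjective {n} h h-inj u with Fin.pigeonhole (ℕ.n<1+n (2 ^ n)) f
    where
    f : Fin (suc (2 ^ n)) → Fin (2 ^ n)
    f Fin.zero    = encode u
    f (Fin.suc i) = encode (h (decode n i))
  ... | Fin.zero  , Fin.suc j , _   , eq = decode n j , sym (encode-injective eq)
  ... | Fin.suc i , Fin.suc j , i<j , eq = contradiction i<j (ℕ.<-irrefl (cong (suc ∘ toℕ) i≡j))
    where
    i≡j : i ≡ j
    i≡j = trans (sym (encode-decode n i)) (trans (cong encode (h-inj (encode-injective eq))) (encode-decode n j))

  -- The threshold 2/3

  ind : Bool → ℕ
  ind b = if b then 1 else 0

  -- The binary digits of 2/3 for `true` and of 1/3 for `false`; dropping the first digit exchanges
  -- the two numbers.
  alt : Bool → ℕ → Bool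
  alt b zero    = b
  alt b (suc i) = alt (not b) i

  -- With b = true, decides 0.y₀y₁…yₙ₋₁ < 2/3 = 0.1010…; with b = false, < 1/3 = 0.0101…
  ltAlt : Bool → ℕ → (ℕ → Bool) → Bool
  ltAlt b     zero    y = true
  ltAlt true  (suc n) y = if y 0 then ltAlt false n (y ∘ suc) else true
  ltAlt false (suc n) y = if y 0 then false else ltAlt true n (y ∘ suc)

  pre : ∀ k → (ℕ → Bool) → Vec Bool k
  pre zero    y = []
  pre (suc k) y = y 0 ∷ pre k (y ∘ suc)

  pre-cong : ∀ k {y y′ : ℕ → Bool} → (∀ i → i < k → y i ≡ y′ i) → pre k y ≡ pre k y′
  pre-cong zero    eq = refl
  pre-cong (suc k) eq = cong₂ _∷_ (eq 0 z<s) (pre-cong k (λ i → eq (suc i) ∘ s<s))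

  pre-injective : ∀ k {y y′ : ℕ → Bool} → pre k y ≡ pre k y′ → ∀ i → i < k → y i ≡ y′ i
  pre-injective (suc k) eq zero    _   = Vec.∷-injectiveˡ eq
  pre-injective (suc k) eq (suc i) i<k = pre-injective k (Vec.∷-injectiveʳ eq) i (s<s⁻¹ i<k)

  -- If the first k digits of f u run once through all of Boolᵏ, then all but the point whose first k
  -- digits are those of the threshold are decided by these digits; the hypothesis on digit k decides the last one.
  sumV-ltAlt : ∀ k n b (f : Vec Bool k → ℕ → Bool) → k < n →
               (∀ u → pre k (f u) ≡ u) → f (pre k (alt b)) k ≡ not (alt b k) →
               3 * sumV (λ u → ind (ltAlt b n (f u))) + ind (not (alt b k))
                 ≡ (if b then 2 else 1) * 2 ^ k + ind (alt b k)
  -- A single point remains, and its next digit is opposite to that of the threshold: it lies below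
  -- 2/3, but not below 1/3.
  sumV-ltAlt zero    (suc n) true  f _   _     eq rewrite eq = refl
  sumV-ltAlt zero    (suc n) false f _   _     eq rewrite eq = refl
  -- Leading digit 0 puts a point below 2/3, so that half counts in full; in the other half the
  -- remaining digits are compared with 1/3.
  sumV-ltAlt (suc k) (suc n) true  f k<n pre-f eq = begin
    3 * (sumV (F false) + sumV (F true)) + i′  ≡⟨ cong (λ x → 3 * x + i′) (cong₂ _+_ (trans (sumV-cong F-false) (sumV-const k 1)) (sumV-cong F-true)) ⟩
    3 * (2 ^ k * 1 + S) + i′                   ≡⟨ solve 3 (λ p s j → con 3 :* (p :* con 1 :+ s) :+ j := con 3 :* p :+ (con 3 :* s :+ j)) refl (2 ^ k) S i′ ⟩
    3 * 2 ^ k + (3 * S + i′)                   ≡⟨ cong (3 * 2 ^ k +_) (sumV-ltAlt k n false f′ (s<s⁻¹ k<n) (λ u → Vec.∷-injectiveʳ (pre-f (true ∷ u))) eq) ⟩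
    3 * 2 ^ k + (1 * 2 ^ k + i)                ≡⟨ solve 2 (λ p j → con 3 :* p :+ (con 1 :* p :+ j) := con 2 :* (con 2 :* p) :+ j) refl (2 ^ k) i ⟩
    2 * 2 ^ suc k + i                          ∎
    where
    open ≡-Reasoning
    open +-*-Solver
    F : Bool → Vec Bool k → ℕ
    F c u = ind (ltAlt true (suc n) (f (c ∷ u)))
    f′ : Vec Bool k → ℕ → Bool
    f′ u = f (true ∷ u) ∘ suc
    S  = sumV (λ u → ind (ltAlt false n (f′ u)))
    i  = ind (alt false k)
    i′ = ind (not (alt false k))
    F-false : ∀ u → F false u ≡ 1
    F-false u rewrite Vec.∷-injectiveˡ (pre-f (false ∷ u)) = refl
    F-true : ∀ u → F true u ≡ ind (ltAlt false n (f′ u))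
    F-true u rewrite Vec.∷-injectiveˡ (pre-f (true ∷ u)) = refl
  -- Leading digit 1 rules a point out; in the other half the remaining digits are compared with
  -- 2/3.
  sumV-ltAlt (suc k) (suc n) false f k<n pre-f eq = begin
    3 * (sumV (F false) + sumV (F true)) + i′  ≡⟨ cong (λ x → 3 * x + i′) (cong₂ _+_ (sumV-cong F-false) (trans (sumV-cong F-true) (sumV-0 k))) ⟩
    3 * (S + 0) + i′                           ≡⟨ cong (λ x → 3 * x + i′) (ℕ.+-identityʳ S) ⟩
    3 * S + i′                                 ≡⟨ sumV-ltAlt k n true f′ (s<s⁻¹ k<n) (λ u → Vec.∷-injectiveʳ (pre-f (false ∷ u))) eq ⟩
    2 * 2 ^ k + i                              ≡⟨ cong (_+ i) (sym (ℕ.*-identityˡ (2 ^ suc k))) ⟩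
    1 * 2 ^ suc k + i                          ∎
    where
    open ≡-Reasoning
    F : Bool → Vec Bool k → ℕ
    F c u = ind (ltAlt false (suc n) (f (c ∷ u)))
    f′ : Vec Bool k → ℕ → Bool
    f′ u = f (false ∷ u) ∘ suc
    S  = sumV (λ u → ind (ltAlt true n (f′ u)))
    i  = ind (alt true k)
    i′ = ind (not (alt true k))
    F-false : ∀ u → F false u ≡ ind (ltAlt true n (f′ u))
    F-false u rewrite Vec.∷-injectiveˡ (pre-f (false ∷ u)) = refl
    F-true : ∀ u → F true u ≡ 0
    F-true u rewrite Vec.∷-injectiveˡ (pre-f (true ∷ u)) = refl

  -- Counting below a dyadic abscissa

  -- The words strictly below `a` are cut into dyadic strips: each digit 1 of `a` contributes all
  -- words that share the digits before it and have 0 in its place.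
  below : ∀ {n} → Vec Bool n → (Vec Bool n → ℕ) → ℕ
  below []          G = 0
  below (false ∷ a) G = below a (G ∘ (false ∷_))
  below (true ∷ a)  G = sumV (G ∘ (false ∷_)) + below a (G ∘ (true ∷_))

  val : ∀ {n} → Vec Bool n → ℕ
  val []              = 0
  val {suc n} (b ∷ a) = ind b * 2 ^ n + val a

  -- The share `E` of the prefix stays unnamed: what matters is that it does not depend on `t`, so
  -- it cancels when two abscissae with a common prefix are compared.
  below-++ : ∀ {m n} (p : Vec Bool m) (G : Vec Bool (m + n) → ℕ) →
             ∃[ E ] ∀ t → below (p ++ t) G ≡ E + below t (G ∘ (p ++_))
  below-++ []          G = 0 , λ _ → refl
  below-++ (false ∷ p) G = below-++ p (G ∘ (false ∷_))
  below-++ (true ∷ p)  G with below-++ p (G ∘ (true ∷_))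
  ... | E , eq = sumV (G ∘ (false ∷_)) + E , λ t →
    trans (cong (sumV (G ∘ (false ∷_)) +_) (eq t)) (sym (ℕ.+-assoc (sumV (G ∘ (false ∷_))) E _))

  val-++ : ∀ {m} n (p : Vec Bool m) → ∃[ V ] ∀ (t : Vec Bool n) → val (p ++ t) ≡ V + val t
  val-++         n []      = 0 , λ _ → refl
  val-++ {suc m} n (b ∷ p) with val-++ n p
  ... | V , eq = ind b * 2 ^ (m + n) + V , λ t →
    trans (cong (ind b * 2 ^ (m + n) +_) (eq t)) (sym (ℕ.+-assoc (ind b * 2 ^ (m + n)) V _))

  -- Padding by zeros lets digits be indexed by all naturals, so that prefixes can be compared
  -- without carrying bounds.
  stream : ∀ {n} → Vec Bool n → ℕ → Bool
  stream []      _       = false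
  stream (b ∷ x) zero    = b
  stream (b ∷ x) (suc i) = stream x i

  -- The net property seen from g, which sends the digits of the first coordinate to those of the second one.
  Separating : ∀ n → (Vec Bool n → ℕ → Bool) → Set
  Separating n g = ∀ k → k ≤ n → ∀ x x′ → (∀ i → i + k < n → stream x i ≡ stream x′ i) →
                   pre k (g x) ≡ pre k (g x′) → x ≡ x′

  -- Putting `b` in front lengthens the words and their common beginning by one digit each while `k`
  -- stays, so the property passes to dyadic strips.
  Separating-∷ : ∀ {n g} b → Separating (suc n) g → Separating n (g ∘ (b ∷_))
  Separating-∷ b sep k k≤n x x′ agree eq = Vec.∷-injectiveʳ
    (sep k (ℕ.m≤n⇒m≤1+n k≤n) (b ∷ x) (b ∷ x′) (λ { zero _ → refl ; (suc i) lt → agree i (s<s⁻¹ lt) }) eq)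

  Separating-++ : ∀ {m n g} (p : Vec Bool m) → Separating (m + n) g → Separating n (g ∘ (p ++_))
  Separating-++ []      sep = sep
  Separating-++ (b ∷ p) sep = Separating-++ p (Separating-∷ b sep)

  -- For `k = n` no agreement of the first coordinates is required.
  Separating⇒injective : ∀ {n g} → Separating n g → Injective (pre n ∘ g)
  Separating⇒injective {n} sep {x} {x′} = sep n ℕ.≤-refl x x′ (λ i lt → contradiction (ℕ.m≤n+m n i) (ℕ.<⇒≱ lt))

  -- The digital shift of the ordinates by `v`. Later the first half of the abscissa produces such
  -- shifts.
  _⊕_ : ∀ {n} → (ℕ → Bool) → (Vec Bool n → ℕ → Bool) → Vec Bool n → ℕ → Bool
  (v ⊕ g) x i = v i xor g x i

  xor-cancelˡ : ∀ a {b c} → a xor b ≡ a xor c → b ≡ c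
  xor-cancelˡ false eq = eq
  xor-cancelˡ true  eq = Bool.not-injective eq

  Separating-⊕ : ∀ {n g} v → Separating n g → Separating n (v ⊕ g)
  Separating-⊕ v sep k k≤n x x′ agree eq =
    sep k k≤n x x′ agree (pre-cong k (λ i i<k → xor-cancelˡ (v i) (pre-injective k eq i i<k)))

  -- Choosing the second half of the abscissa

  same : Bool → Bool → Bool
  same b c = not (b xor c)

  -- Each digit is chosen by the parity of `k`, the number of digits after it, because this parity
  -- decides the sign of the strip's contribution: `s = true` collects the positive ones and
  -- `s = false` the negative ones.
  altTail : Bool → ∀ n → Vec Bool n
  altTail s zero    = []
  altTail s (suc k) = same (alt true k) s ∷ altTail s k

  -- Whenever altTail s has a digit 1 with k digits after it, the one point of the corresponding dyadic strip
  -- that shares its first k digits with 2/3 has there the digit other than that of 2/3.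
  Steered : Bool → ∀ n → (Vec Bool n → ℕ → Bool) → Set
  Steered s zero    g = ⊤
  Steered s (suc k) g =
    (alt true k ≡ s → ∀ z → pre k (g (false ∷ z)) ≡ pre k (alt true) → g (false ∷ z) k ≡ not s) ×
    Steered s k (g ∘ (same (alt true k) s ∷_))

  Steered-cong : ∀ s n {g g′} → (∀ z i → i < n → g z i ≡ g′ z i) → Steered s n g → Steered s n g′
  Steered-cong s zero    eq tt             = tt
  Steered-cong s (suc k) eq (here , there) =
    (λ a≡s z pre≡ → trans (sym (eq _ k ℕ.≤-refl))
       (here a≡s z (trans (pre-cong k (λ i i<k → eq _ i (ℕ.m<n⇒m<1+n i<k))) pre≡))) ,
    Steered-cong s k (λ z i i<k → eq _ i (ℕ.m<n⇒m<1+n i<k)) there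

  update : (ℕ → Bool) → ℕ → Bool → ℕ → Bool
  update v k b i = if does (i ℕ.≟ k) then b else v i

  update-≡ : ∀ v k b → update v k b k ≡ b
  update-≡ v k b = cong (if_then b else v k) (dec-true (k ℕ.≟ k) refl)

  update-< : ∀ v {k} b {i} → i < k → update v k b i ≡ v i
  update-< v {k} b {i} i<k = cong (if_then b else v i) (dec-false (i ℕ.≟ k) (ℕ.<⇒≢ i<k))

  -- The digit at index k of v only matters for the sign s = alt true k, so both signs can be steered by the same v.
  steer : ∀ n (g : Bool → Vec Bool n → ℕ → Bool) → (∀ s → Separating n (g s)) →
          ∃[ v ] ∀ s → Steered s n (v ⊕ g s)
  steer zero    g sep = (λ _ → false) , λ _ → tt
  steer (suc k) g sep = v′ , λ s →
    (λ { refl z pre≡ → hit z pre≡ }) ,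
    Steered-cong s k (λ z i i<k → cong (_xor g s _ i) (sym (update-< v b i<k))) (v-steers s)
    where
    s* = alt true k
    -- The later digits are steered first. Their conditions involve only the indices below `k`, so
    -- digit `k` of the shift is still free.
    rec = steer k (λ s → g s ∘ (same (alt true k) s ∷_)) (λ s → Separating-∷ _ (sep s))
    v = proj₁ rec
    v-steers = proj₂ rec
    strip : Vec Bool k → ℕ → Bool
    strip = g s* ∘ (false ∷_)
    inj : Injective (pre k ∘ (v ⊕ strip))
    inj = Separating⇒injective (Separating-⊕ v (Separating-∷ false (sep s*)))
    -- The only point of the strip that the first `k` digits leave undecided.
    z* = proj₁ (injective⇒surjective (pre k ∘ (v ⊕ strip)) inj (pre k (alt true)))
    pre-z* = proj₂ (injective⇒surjective (pre k ∘ (v ⊕ strip)) inj (pre k (alt true)))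
    -- The shift that turns digit `k` of `z*` into `not s*`.
    b = not s* xor strip z* k
    v′ = update v k b
    hit : ∀ z → pre k ((v′ ⊕ strip) z) ≡ pre k (alt true) → (v′ ⊕ strip) z k ≡ not s*
    hit z pre≡ = begin
      v′ k xor strip z k                             ≡⟨ cong₂ (λ c w → c xor strip w k) (update-≡ v k b) z≡z* ⟩
      (not s* xor strip z* k) xor strip z* k         ≡⟨ Bool.xor-assoc (not s*) _ _ ⟩
      not s* xor (strip z* k xor strip z* k)         ≡⟨ cong (not s* xor_) (Bool.xor-same (strip z* k)) ⟩
      not s* xor false                               ≡⟨ Bool.xor-identityʳ (not s*) ⟩
      not s*                                         ∎
      where
      open ≡-Reasoning
      z≡z* : z ≡ z*
      z≡z* = inj (trans (pre-cong k (λ i i<k → cong (_xor strip z i) (sym (update-< v b i<k))))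
                        (trans pre≡ (sym pre-z*)))

  count-alt : Bool → ℕ → ℕ
  count-alt s zero    = 0
  count-alt s (suc k) = ind (same (alt true k) s) + count-alt s k

  -- At each position exactly one of the two tails has a digit 1.
  count-alt-sum : ∀ n → count-alt true n + count-alt false n ≡ n
  count-alt-sum zero = refl
  count-alt-sum (suc k) with alt true k
  ... | true  = cong suc (count-alt-sum k)
  ... | false = trans (ℕ.+-suc _ _) (cong suc (count-alt-sum k))

  -- The first `k` digits of the ordinate run through the cube bijectively, so they can serve as
  -- parameters of the strip, and `sumV-ltAlt` applies. The equation says that the count differs
  -- from two thirds of `2 ^ k` by 1/3, with the sign of `alt true k`; it is cleared of fractions
  -- and subtraction.
  strip-sum : ∀ k L (g : Vec Bool k → ℕ → Bool) → k < L → Separating k g →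
              (∀ z → pre k (g z) ≡ pre k (alt true) → g z k ≡ not (alt true k)) →
              3 * sumV (λ z → ind (ltAlt true L (g z))) + ind (not (alt true k)) ≡ 2 * 2 ^ k + ind (alt true k)
  strip-sum k L g k<L sep miss = trans
    (cong (λ S → 3 * S + ind (not (alt true k))) (sumV-reindex h h⁻¹ hh⁻¹ (λ z → inj (hh⁻¹ (h z))) _))
    (sumV-ltAlt k L true (g ∘ h⁻¹) k<L hh⁻¹ (miss _ (hh⁻¹ _)))
    where
    h = pre k ∘ g
    inj : Injective h
    inj = Separating⇒injective sep
    h⁻¹ : Vec Bool k → Vec Bool k
    h⁻¹ u = proj₁ (injective⇒surjective h inj u)
    hh⁻¹ : ∀ u → h (h⁻¹ u) ≡ u
    hh⁻¹ u = proj₂ (injective⇒surjective h inj u)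

  -- All strips of one tail err in the same direction, so their thirds add up to `count-alt s n`.
  -- The conditionals put this surplus or deficit on the side where no subtraction arises. `L` is
  -- the full number of digits and stays fixed in the induction.
  altTail-below : ∀ s n L (g : Vec Bool n → ℕ → Bool) → n ≤ L → Separating n g → Steered s n g →
                  3 * below (altTail s n) (λ z → ind (ltAlt true L (g z))) + (if s then 0 else count-alt s n)
                    ≡ 2 * val (altTail s n) + (if s then count-alt s n else 0)
  altTail-below true  zero    L g n≤L sep _ = refl
  altTail-below false zero    L g n≤L sep _ = refl
  altTail-below s     (suc k) L g n≤L sep (here , there)
    with alt true k | strip-sum k L (g ∘ (false ∷_)) n≤L (Separating-∷ false sep) | s
  ... | true | strip | true = begin
    3 * (S + B) + 0                    ≡⟨ solve 2 (λ s b → con 3 :* (s :+ b) :+ con 0 := (con 3 :* s :+ con 0) :+ (con 3 :* b :+ con 0)) refl S B ⟩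
    (3 * S + 0) + (3 * B + 0)          ≡⟨ cong₂ _+_ (strip (here refl)) (altTail-below true k L (g ∘ (true ∷_)) (ℕ.<⇒≤ n≤L) (Separating-∷ true sep) there) ⟩
    (2 * 2 ^ k + 1) + (2 * V + C)      ≡⟨ solve 3 (λ p v c → (con 2 :* p :+ con 1) :+ (con 2 :* v :+ c) := con 2 :* (con 1 :* p :+ v) :+ (con 1 :+ c)) refl (2 ^ k) V C ⟩
    2 * (1 * 2 ^ k + V) + suc C        ∎
    where
    open ≡-Reasoning
    open +-*-Solver
    G : Vec Bool (suc k) → ℕ
    G z = ind (ltAlt true L (g z))
    S = sumV (G ∘ (false ∷_))
    B = below (altTail true k) (G ∘ (true ∷_))
    V = val (altTail true k)
    C = count-alt true k
  ... | false | strip | false = begin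
    3 * (S + B) + suc C                ≡⟨ solve 3 (λ s b c → con 3 :* (s :+ b) :+ (con 1 :+ c) := (con 3 :* s :+ con 1) :+ (con 3 :* b :+ c)) refl S B C ⟩
    (3 * S + 1) + (3 * B + C)          ≡⟨ cong₂ _+_ (strip (here refl)) (altTail-below false k L (g ∘ (true ∷_)) (ℕ.<⇒≤ n≤L) (Separating-∷ true sep) there) ⟩
    (2 * 2 ^ k + 0) + (2 * V + 0)      ≡⟨ solve 2 (λ p v → (con 2 :* p :+ con 0) :+ (con 2 :* v :+ con 0) := con 2 :* (con 1 :* p :+ v) :+ con 0) refl (2 ^ k) V ⟩
    2 * (1 * 2 ^ k + V) + 0            ∎
    where
    open ≡-Reasoning
    open +-*-Solver
    G : Vec Bool (suc k) → ℕ
    G z = ind (ltAlt true L (g z))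
    S = sumV (G ∘ (false ∷_))
    B = below (altTail false k) (G ∘ (true ∷_))
    V = val (altTail false k)
    C = count-alt false k
  -- In the last two cases the abscissa has digit 0, so no strip is added.
  ... | true  | _ | false = altTail-below false k L (g ∘ (false ∷_)) (ℕ.<⇒≤ n≤L) (Separating-∷ false sep) there
  ... | false | _ | true  = altTail-below true k L (g ∘ (false ∷_)) (ℕ.<⇒≤ n≤L) (Separating-∷ false sep) there

  -- The two abscissae share their first half, so its uncontrolled contribution cancels in the difference.
  opposite-abscissae : ∀ h e (Y : Vec Bool (h + (e + h)) → ℕ → Bool) → Separating (h + (e + h)) Y →
    (∀ v → ∃[ p ] ∀ (q : Vec Bool (e + h)) i → i < h → Y (_++_ {m = h} p q) i ≡ v i xor Y (replicate h false ++ q) i) →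
    let G = λ x → ind (ltAlt true (h + (e + h)) (Y x)) in
    ∃[ a ] ∃[ a′ ] 3 * below a G + 2 * val a′ ≡ 3 * below a′ G + 2 * val a + h
  opposite-abscissae h e Y sep surj = a true , a false , (begin
    3 * below (a true) G + 2 * val (a false)      ≡⟨ cong₂ (λ x y → 3 * x + 2 * y) (split-below true) (split-val false) ⟩
    3 * (E + B true) + 2 * (V + W false)          ≡⟨ solve 4 (λ E V B W → con 3 :* (E :+ B) :+ con 2 :* (V :+ W) := con 3 :* E :+ con 2 :* V :+ (con 3 :* B :+ con 0) :+ (con 2 :* W :+ con 0)) refl E V (B true) (W false) ⟩
    3 * E + 2 * V + (3 * B true + 0) + (2 * W false + 0)
      ≡⟨ cong₂ (λ x y → 3 * E + 2 * V + x + y) (tail-below true) (sym (tail-below false)) ⟩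
    3 * E + 2 * V + (2 * W true + count-alt true h) + (3 * B false + count-alt false h)
      ≡⟨ solve 6 (λ E V B W c d → con 3 :* E :+ con 2 :* V :+ (con 2 :* W :+ c) :+ (con 3 :* B :+ d) := con 3 :* (E :+ B) :+ con 2 :* (V :+ W) :+ (c :+ d)) refl E V (B false) (W true) (count-alt true h) (count-alt false h) ⟩
    3 * (E + B false) + 2 * (V + W true) + (count-alt true h + count-alt false h)
      ≡⟨ cong₂ _+_ (cong₂ (λ x y → 3 * x + 2 * y) (sym (split-below false)) (sym (split-val true))) (count-alt-sum h) ⟩
    3 * below (a false) G + 2 * val (a true) + h  ∎)
    where
    open ≡-Reasoning
    open +-*-Solver
    G : Vec Bool (h + (e + h)) → ℕ
    G x = ind (ltAlt true (h + (e + h)) (Y x))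
    -- The digits between the two halves are set to 0 and contribute no strips.
    zeros = replicate e false
    shifted : Vec Bool h → ℕ → Bool
    shifted t = Y (replicate h false ++ (zeros ++ t))
    -- Both signs start from the same map; they part only within the recursion, where the two tails
    -- differ.
    steering = steer h (λ _ → shifted) (λ _ → Separating-++ zeros (Separating-++ (replicate h false) sep))
    -- The shift found by `steer` is realised by a choice of the first half.
    solution = surj (proj₁ steering)
    p : Vec Bool h
    p = proj₁ solution
    a : Bool → Vec Bool (h + (e + h))
    a s = p ++ (zeros ++ altTail s h)
    tailG : Vec Bool h → ℕ
    tailG t = G (p ++ (zeros ++ t))
    B W : Bool → ℕ
    B s = below (altTail s h) tailG
    W s = val (altTail s h)
    below₁ = below-++ p G
    below₂ = below-++ zeros (G ∘ (p ++_))
    val₁ = val-++ (e + h) p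
    val₂ = val-++ h zeros
    E = proj₁ below₁ + proj₁ below₂
    V = proj₁ val₁ + proj₁ val₂
    split-below : ∀ s → below (a s) G ≡ E + B s
    split-below s = trans (proj₂ below₁ (zeros ++ altTail s h))
      (trans (cong (proj₁ below₁ +_) (proj₂ below₂ (altTail s h))) (sym (ℕ.+-assoc (proj₁ below₁) _ _)))
    split-val : ∀ s → val (a s) ≡ V + W s
    split-val s = trans (proj₂ val₁ (zeros ++ altTail s h))
      (trans (cong (proj₁ val₁ +_) (proj₂ val₂ (altTail s h))) (sym (ℕ.+-assoc (proj₁ val₁) _ _)))
    tail-below : ∀ s → 3 * B s + (if s then 0 else count-alt s h) ≡ 2 * W s + (if s then count-alt s h else 0)
    tail-below s = altTail-below s h (h + (e + h)) (λ t → Y (p ++ (zeros ++ t))) (ℕ.m≤m+n h (e + h))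
      (Separating-++ zeros (Separating-++ p sep))
      (Steered-cong s h (λ t i i<h → sym (proj₂ solution (zeros ++ t) i i<h)) (proj₂ steering s))

  -- Linear algebra over ℤ₂

  ⊕sum-cong : ∀ {n} {f g : Fin n → Bool} → f ≗ g → ⊕sum f ≡ ⊕sum g
  ⊕sum-cong {zero}  f≗g = refl
  ⊕sum-cong {suc n} f≗g = cong₂ _xor_ (f≗g Fin.zero) (⊕sum-cong (f≗g ∘ Fin.suc))

  ⊕sum-false : ∀ {n} {f : Fin n → Bool} → (∀ i → f i ≡ false) → ⊕sum f ≡ false
  ⊕sum-false {zero}  f≡0 = refl
  ⊕sum-false {suc n} f≡0 = cong₂ _xor_ (f≡0 Fin.zero) (⊕sum-false (f≡0 ∘ Fin.suc))

  ⊕sum-xor : ∀ {n} (f g : Fin n → Bool) → ⊕sum (λ i → f i xor g i) ≡ ⊕sum f xor ⊕sum g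
  ⊕sum-xor {zero}  f g = refl
  ⊕sum-xor {suc n} f g = trans (cong ((f Fin.zero xor g Fin.zero) xor_) (⊕sum-xor (f ∘ Fin.suc) (g ∘ Fin.suc)))
    (interchange (f Fin.zero) (g Fin.zero) (⊕sum (f ∘ Fin.suc)) (⊕sum (g ∘ Fin.suc)))

  ∧-⊕sum : ∀ {n} b (f : Fin n → Bool) → b ∧ ⊕sum f ≡ ⊕sum (λ i → b ∧ f i)
  ∧-⊕sum {zero}  b f = Bool.∧-zeroʳ b
  ∧-⊕sum {suc n} b f = trans (Bool.∧-distribˡ-xor b (f Fin.zero) _) (cong ((b ∧ f Fin.zero) xor_) (∧-⊕sum b (f ∘ Fin.suc)))

  ⊕sum-∧ : ∀ {n} (f : Fin n → Bool) b → ⊕sum f ∧ b ≡ ⊕sum (λ i → f i ∧ b)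
  ⊕sum-∧ f b = trans (Bool.∧-comm _ b) (trans (∧-⊕sum b f) (⊕sum-cong (λ i → Bool.∧-comm b (f i))))

  ⊕sum-swap : ∀ {m n} (f : Fin m → Fin n → Bool) →
              ⊕sum (λ i → ⊕sum (f i)) ≡ ⊕sum (λ j → ⊕sum (λ i → f i j))
  ⊕sum-swap {zero} {n} f = sym (⊕sum-false {n = n} (λ _ → refl))
  ⊕sum-swap {suc m}    f = trans (cong (⊕sum (f Fin.zero) xor_) (⊕sum-swap (f ∘ Fin.suc)))
    (sym (⊕sum-xor (f Fin.zero) (λ j → ⊕sum (λ i → f (Fin.suc i) j))))

  ⊕sum-↑ : ∀ m {n} (f : Fin (m + n) → Bool) →
           ⊕sum f ≡ ⊕sum (λ i → f (i ↑ˡ n)) xor ⊕sum (λ j → f (m ↑ʳ j))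
  ⊕sum-↑ zero    f = refl
  ⊕sum-↑ (suc m) f = trans (cong (f Fin.zero xor_) (⊕sum-↑ m (f ∘ Fin.suc))) (sym (Bool.xor-assoc (f Fin.zero) _ _))

  apply : ∀ {r s} → Mat r s → (Fin s → Bool) → Fin r → Bool
  apply M x i = ⊕sum (λ j → M i j ∧ x j)

  apply-∘ : ∀ {r s t} (M : Mat r s) (N : Mat s t) x → apply M (apply N x) ≗ apply (M · N) x
  apply-∘ M N x i = begin
    ⊕sum (λ j → M i j ∧ ⊕sum (λ k → N j k ∧ x k))    ≡⟨ ⊕sum-cong (λ j → ∧-⊕sum (M i j) (λ k → N j k ∧ x k)) ⟩
    ⊕sum (λ j → ⊕sum (λ k → M i j ∧ (N j k ∧ x k)))  ≡⟨ ⊕sum-swap (λ j k → M i j ∧ (N j k ∧ x k)) ⟩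
    ⊕sum (λ k → ⊕sum (λ j → M i j ∧ (N j k ∧ x k)))  ≡⟨ ⊕sum-cong (λ k → ⊕sum-cong (λ j → sym (Bool.∧-assoc (M i j) (N j k) (x k)))) ⟩
    ⊕sum (λ k → ⊕sum (λ j → (M i j ∧ N j k) ∧ x k))  ≡⟨ ⊕sum-cong (λ k → sym (⊕sum-∧ (λ j → M i j ∧ N j k) (x k))) ⟩
    ⊕sum (λ k → (M · N) i k ∧ x k)                   ∎
    where
    open ≡-Reasoning

  apply-xor : ∀ {r s} (M : Mat r s) x y → apply M (λ j → x j xor y j) ≗ (λ i → apply M x i xor apply M y i)
  apply-xor M x y i = trans (⊕sum-cong (λ j → Bool.∧-distribˡ-xor (M i j) (x j) (y j))) (⊕sum-xor (λ j → M i j ∧ x j) (λ j → M i j ∧ y j))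

  apply-cong : ∀ {r s} (M : Mat r s) {x y} → x ≗ y → apply M x ≗ apply M y
  apply-cong M x≗y i = ⊕sum-cong (λ j → cong (M i j ∧_) (x≗y j))

  idMat-suc : ∀ {m} (i j : Fin m) → idMat (suc m) (Fin.suc i) (Fin.suc j) ≡ idMat m i j
  idMat-suc i j with i Fin.≟ j
  ... | yes _ = refl
  ... | no  _ = refl

  idMat-sym : ∀ {m} (i j : Fin m) → idMat m i j ≡ idMat m j i
  idMat-sym Fin.zero    Fin.zero    = refl
  idMat-sym Fin.zero    (Fin.suc j) = refl
  idMat-sym (Fin.suc i) Fin.zero    = refl
  idMat-sym (Fin.suc i) (Fin.suc j) = trans (idMat-suc i j) (trans (idMat-sym i j) (sym (idMat-suc j i)))

  apply-idMat : ∀ {m} (x : Fin m → Bool) → apply (idMat m) x ≗ x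
  apply-idMat {suc m} x Fin.zero    = trans (cong (x Fin.zero xor_) (⊕sum-false {n = m} (λ _ → refl))) (Bool.xor-identityʳ _)
  apply-idMat {suc m} x (Fin.suc i) = trans (⊕sum-cong (λ j → cong (_∧ x (Fin.suc j)) (idMat-suc i j))) (apply-idMat (x ∘ Fin.suc) i)

  xor≡false : ∀ {a b} → a xor b ≡ false → a ≡ b
  xor≡false {false} {false} _ = refl
  xor≡false {true}  {true}  _ = refl

  ≡⇒xor≡false : ∀ {a b} → a ≡ b → a xor b ≡ false
  ≡⇒xor≡false {a} refl = Bool.xor-same a

  vec-ext : ∀ {n} {x y : Vec Bool n} → (∀ i → lookup x i ≡ lookup y i) → x ≡ y
  vec-ext {x = x} {y} eq = trans (sym (Vec.tabulate∘lookup x)) (trans (Vec.tabulate-cong eq) (Vec.tabulate∘lookup y))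

  stream-toℕ : ∀ {n} (x : Vec Bool n) i → stream x (toℕ i) ≡ lookup x i
  stream-toℕ (b ∷ x) Fin.zero    = refl
  stream-toℕ (b ∷ x) (Fin.suc i) = stream-toℕ x i

  stream-≥ : ∀ {n} (x : Vec Bool n) {i} → n ≤ i → stream x i ≡ false
  stream-≥ []      _                 = refl
  stream-≥ (b ∷ x) {suc i} (s≤s n≤i) = stream-≥ x n≤i

  -- The hypotheses on the matrices as statements about digits

  image : ∀ {m} → Mat m m → Vec Bool m → ℕ → Bool
  image C x = stream (tabulate (apply C (lookup x)))

  image-toℕ : ∀ {m} (C : Mat m m) x r → image C x (toℕ r) ≡ apply C (lookup x) r
  image-toℕ C x r = trans (stream-toℕ (tabulate (apply C (lookup x))) r) (Vec.lookup∘tabulate _ r)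

  -- The net property makes the rows of the upper right k×k block of C independent. Hence, by counting, its rows
  -- span ℤ₂ᵏ, and every coordinate of w beyond the first d is a combination of the first k entries of C w.
  net-kernel : ∀ d k (C : Mat (d + k) (d + k)) → IsDigital0m2Net (idMat (d + k)) C →
               ∀ w → (∀ i → toℕ i < d → w i ≡ false) → (∀ r → toℕ r < k → apply C w r ≡ false) →
               ∀ j → w (d ↑ʳ j) ≡ false
  net-kernel d k C net w w-low Cw-low j = begin
    w (d ↑ʳ j)                                                          ≡⟨ sym (apply-idMat (w ∘ (d ↑ʳ_)) j) ⟩
    ⊕sum (λ l → idMat k j l ∧ w (d ↑ʳ l))                               ≡⟨ ⊕sum-cong (λ l → cong (_∧ w (d ↑ʳ l)) (sym (comb-j l))) ⟩
    ⊕sum (λ l → comb (coeff b) (d ↑ʳ l) ∧ w (d ↑ʳ l))                   ≡⟨ cong (_xor ⊕sum (λ l → comb (coeff b) (d ↑ʳ l) ∧ w (d ↑ʳ l))) (sym (⊕sum-false low-part)) ⟩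
    ⊕sum (λ i → comb (coeff b) (i ↑ˡ k) ∧ w (i ↑ˡ k)) xor ⊕sum (λ l → comb (coeff b) (d ↑ʳ l) ∧ w (d ↑ʳ l))
                                                                        ≡⟨ sym (⊕sum-↑ d (λ l → comb (coeff b) l ∧ w l)) ⟩
    ⊕sum (λ l → comb (coeff b) l ∧ w l)                                 ≡⟨ ⊕sum-cong (λ l → ⊕sum-∧ (λ r → coeff b r ∧ C r l) (w l)) ⟩
    ⊕sum (λ l → ⊕sum (λ r → (coeff b r ∧ C r l) ∧ w l))                 ≡⟨ ⊕sum-swap (λ l r → (coeff b r ∧ C r l) ∧ w l) ⟩
    ⊕sum (λ r → ⊕sum (λ l → (coeff b r ∧ C r l) ∧ w l))                 ≡⟨ ⊕sum-cong (λ r → trans (⊕sum-cong (λ l → Bool.∧-assoc (coeff b r) (C r l) (w l))) (sym (∧-⊕sum (coeff b r) (λ l → C r l ∧ w l)))) ⟩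
    ⊕sum (λ r → coeff b r ∧ apply C w r)                                ≡⟨ ⊕sum-false all-false ⟩
    false                                                               ∎
    where
    open ≡-Reasoning
    coeff : Vec Bool k → Fin (d + k) → Bool
    coeff b r = stream b (toℕ r)
    comb : (Fin (d + k) → Bool) → Fin (d + k) → Bool
    comb β l = ⊕sum (λ r → β r ∧ C r l)
    h : Vec Bool k → Vec Bool k
    h b = tabulate (λ l → comb (coeff b) (d ↑ʳ l))

    h-injective : Injective h
    h-injective {b} {b′} hb≡hb′ = vec-ext same-entry
      where
      β : Fin (d + k) → Bool
      β r = coeff b r xor coeff b′ r
      comb-β : ∀ l → comb β l ≡ comb (coeff b) l xor comb (coeff b′) l
      comb-β l = trans (⊕sum-cong (λ r → Bool.∧-distribʳ-xor (C r l) (coeff b r) (coeff b′ r)))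
                       (⊕sum-xor (λ r → coeff b r ∧ C r l) (λ r → coeff b′ r ∧ C r l))
      high : ∀ l → comb β (d ↑ʳ l) ≡ false
      high l = trans (comb-β (d ↑ʳ l)) (≡⇒xor≡false
        (trans (sym (Vec.lookup∘tabulate _ l)) (trans (cong (λ v → lookup v l) hb≡hb′) (Vec.lookup∘tabulate _ l))))
      -- The combination of rows of `C` vanishes in the last `k` places, so unit vectors, the first
      -- `d` rows of the identity, cancel what is left of it.
      α : Fin (d + k) → Bool
      α i = if does (toℕ i ℕ.<? d) then comb β i else false
      α-high : ∀ i → d ≤ toℕ i → α i ≡ false
      α-high i d≤i = cong (if_then comb β i else false) (dec-false (toℕ i ℕ.<? d) (ℕ.≤⇒≯ d≤i))
      α-cancels : ∀ l → α l ≡ comb β l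
      α-cancels l with toℕ l ℕ.<? d
      ... | yes l<d = cong (if_then comb β l else false) (dec-true (toℕ l ℕ.<? d) l<d)
      ... | no  l≮d = trans (α-high l (ℕ.≮⇒≥ l≮d)) (sym (subst (λ l → comb β l ≡ false)
        (Fin.toℕ-injective (trans (Fin.toℕ-↑ʳ d l′) (trans (cong (d +_) (Fin.toℕ-fromℕ< _)) (ℕ.m+[n∸m]≡n (ℕ.≮⇒≥ l≮d))))) (high l′)))
        where
        l′ : Fin k
        l′ = fromℕ< {toℕ l ℕ.∸ d} (ℕ.+-cancelˡ-< d _ _ (subst (_< d + k) (sym (ℕ.m+[n∸m]≡n (ℕ.≮⇒≥ l≮d))) (Fin.toℕ<n l)))
      vanishes : ∀ l → ⊕sum (λ i → (α i ∧ idMat (d + k) i l) xor (β i ∧ C i l)) ≡ false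
      vanishes l = trans (⊕sum-xor (λ i → α i ∧ idMat (d + k) i l) (λ i → β i ∧ C i l)) (≡⇒xor≡false
        (trans (⊕sum-cong (λ i → trans (Bool.∧-comm (α i) _) (cong (_∧ α i) (idMat-sym i l)))) (trans (apply-idMat α l) (α-cancels l))))
      β≡0 : ∀ r → β r ≡ false
      β≡0 = proj₂ (net d k refl α β α-high (λ r k≤r → ≡⇒xor≡false (trans (stream-≥ b k≤r) (sym (stream-≥ b′ k≤r)))) vanishes)
      same-entry : ∀ i → lookup b i ≡ lookup b′ i
      same-entry i = begin
        lookup b i         ≡⟨ sym (stream-toℕ b i) ⟩
        stream b (toℕ i)   ≡⟨ cong (stream b) (sym r≡i) ⟩
        stream b (toℕ r)   ≡⟨ xor≡false (β≡0 r) ⟩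
        stream b′ (toℕ r)  ≡⟨ cong (stream b′) r≡i ⟩
        stream b′ (toℕ i)  ≡⟨ stream-toℕ b′ i ⟩
        lookup b′ i        ∎
        where
        r = Fin.inject≤ i (ℕ.m≤n+m k d)
        r≡i = Fin.toℕ-inject≤ i (ℕ.m≤n+m k d)

    -- A combination of the first `k` rows of `C` that ends in the `j`-th unit vector; its first `d`
    -- entries will only meet zeros of `w`.
    b = proj₁ (injective⇒surjective h h-injective (tabulate (idMat k j)))
    hb = proj₂ (injective⇒surjective h h-injective (tabulate (idMat k j)))
    comb-j : ∀ l → comb (coeff b) (d ↑ʳ l) ≡ idMat k j l
    comb-j l = trans (sym (Vec.lookup∘tabulate _ l)) (trans (cong (λ v → lookup v l) hb) (Vec.lookup∘tabulate _ l))
    low-part : ∀ i → comb (coeff b) (i ↑ˡ k) ∧ w (i ↑ˡ k) ≡ false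
    low-part i = trans (cong (comb (coeff b) (i ↑ˡ k) ∧_) (w-low _ (subst (_< d) (sym (Fin.toℕ-↑ˡ i k)) (Fin.toℕ<n i)))) (Bool.∧-zeroʳ _)
    all-false : ∀ r → coeff b r ∧ apply C w r ≡ false
    all-false r with toℕ r ℕ.<? k
    ... | yes r<k = trans (cong (coeff b r ∧_) (Cw-low r r<k)) (Bool.∧-zeroʳ _)
    ... | no  r≮k = cong (_∧ apply C w r) (stream-≥ b (ℕ.≮⇒≥ r≮k))

  -- By linearity it suffices to treat the difference `w` of the two words. It vanishes in the first
  -- `m - k` places and so do the first `k` entries of `C w`, so `net-kernel` with `d = m - k` gives
  -- the rest.
  net⇒Separating : ∀ {m} (C : Mat m m) → IsDigital0m2Net (idMat m) C → Separating m (image C)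
  net⇒Separating {m} C net k k≤m x x′ agree eq = vec-ext (λ i → xor≡false (w≡0 (ℕ.m∸n+n≡m k≤m) C net w w-low Cw-low i))
    where
    w : Fin m → Bool
    w i = lookup x i xor lookup x′ i
    w-low : ∀ i → toℕ i + k < m → w i ≡ false
    w-low i lt = ≡⇒xor≡false (trans (sym (stream-toℕ x i)) (trans (agree (toℕ i) lt) (stream-toℕ x′ i)))
    Cw-low : ∀ r → toℕ r < k → apply C w r ≡ false
    Cw-low r r<k = trans (apply-xor C (lookup x) (lookup x′) r) (≡⇒xor≡false
      (trans (sym (image-toℕ C x r)) (trans (pre-injective k eq (toℕ r) r<k) (image-toℕ C x′ r))))
    w≡0 : ∀ {d m} → d + k ≡ m → (C : Mat m m) → IsDigital0m2Net (idMat m) C → ∀ w →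
          (∀ i → toℕ i + k < m → w i ≡ false) → (∀ r → toℕ r < k → apply C w r ≡ false) → ∀ i → w i ≡ false
    w≡0 {d} refl C net w w-low Cw-low i with Fin.splitAt d i | Fin.join-splitAt d k i
    ... | inj₁ i′ | refl = w-low _ (ℕ.+-monoˡ-< k (subst (_< d) (sym (Fin.toℕ-↑ˡ i′ k)) (Fin.toℕ<n i′)))
    ... | inj₂ j  | refl = net-kernel d k C net w (λ i i<d → w-low i (ℕ.+-monoˡ-< k i<d)) Cw-low j

  -- Take `p` as the inverse of `A` applied to `v`. The first `h` digits of the image of `p ++ q`
  -- are then `v + B q`, and `B q` is what a zero first half gives.
  nonsingular⇒surjective : ∀ {h r} (C : Mat (h + r) (h + r)) → Nonsingular {h} (λ i j → C (i ↑ˡ r) (j ↑ˡ r)) →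
    ∀ v → ∃[ p ] ∀ (q : Vec Bool r) i → i < h → image C (_++_ {m = h} p q) i ≡ v i xor image C (replicate h false ++ q) i
  nonsingular⇒surjective {h} {r} C (N , AN≡I , _) v = p , λ q i i<h → begin
    image C (p ++ q) i                                   ≡⟨ image-split p q (fromℕ< i<h) i (Fin.toℕ-fromℕ< i<h) ⟩
    apply A (lookup p) (fromℕ< i<h) xor apply B (lookup q) (fromℕ< i<h)
                                                         ≡⟨ cong (_xor apply B (lookup q) (fromℕ< i<h)) (Ap≡v i i<h) ⟩
    v i xor apply B (lookup q) (fromℕ< i<h)              ≡⟨ cong (λ b → v i xor (b xor apply B (lookup q) (fromℕ< i<h))) (sym (A0≡0 (fromℕ< i<h))) ⟩
    v i xor (apply A (lookup (replicate h false)) (fromℕ< i<h) xor apply B (lookup q) (fromℕ< i<h))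
                                                         ≡⟨ cong (v i xor_) (sym (image-split (replicate h false) q (fromℕ< i<h) i (Fin.toℕ-fromℕ< i<h))) ⟩
    v i xor image C (replicate h false ++ q) i           ∎
    where
    open ≡-Reasoning
    A : Mat h h
    A i j = C (i ↑ˡ r) (j ↑ˡ r)
    B : Mat h r
    B i j = C (i ↑ˡ r) (h ↑ʳ j)
    p : Vec Bool h
    p = tabulate (apply N (v ∘ toℕ))
    image-split : ∀ (p : Vec Bool h) (q : Vec Bool r) f i → toℕ f ≡ i →
                  image C (p ++ q) i ≡ apply A (lookup p) f xor apply B (lookup q) f
    image-split p q f _ refl = trans (trans (cong (image C (p ++ q)) (sym (Fin.toℕ-↑ˡ f r))) (image-toℕ C (p ++ q) (f ↑ˡ r)))
      (trans (⊕sum-↑ h _) (cong₂ _xor_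
        (⊕sum-cong (λ j → cong (A f j ∧_) (Vec.lookup-++ˡ p q j)))
        (⊕sum-cong (λ j → cong (B f j ∧_) (Vec.lookup-++ʳ p q j)))))
    Ap≡v : ∀ i (i<h : i < h) → apply A (lookup p) (fromℕ< i<h) ≡ v i
    Ap≡v i i<h = begin
      apply A (lookup p) f           ≡⟨ apply-cong A (Vec.lookup∘tabulate _) f ⟩
      apply A (apply N (v ∘ toℕ)) f  ≡⟨ apply-∘ A N (v ∘ toℕ) f ⟩
      apply (A · N) (v ∘ toℕ) f      ≡⟨ ⊕sum-cong (λ j → cong (_∧ v (toℕ j)) (AN≡I f j)) ⟩
      apply (idMat h) (v ∘ toℕ) f    ≡⟨ apply-idMat (v ∘ toℕ) f ⟩
      v (toℕ f)                      ≡⟨ cong v (Fin.toℕ-fromℕ< i<h) ⟩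
      v i                            ∎
      where f = fromℕ< i<h
    A0≡0 : ∀ f → apply A (lookup (replicate h false)) f ≡ false
    A0≡0 f = ⊕sum-false (λ j → trans (cong (A f j ∧_) (Vec.lookup-replicate j false)) (Bool.∧-zeroʳ _))

-- Rational coordinates, and the passage from digit counts to the star discrepancy

module BoxDiscrepancy where

  open DigitalStrips
  open import Data.Integer using (+_)
  open import Data.Rational using (ℚ; 0ℚ; 1ℚ; ½; _+_; _-_; -_; _*_; _/_; _<_; _≤_; _<?_; ∣_∣; toℚᵘ)
  open import Data.Rational.Unnormalised using (mkℚᵘ; *≡*)
  open Data.Rational.Solver using (module +-*-Solver)
  private module ℕSolver = Data.Nat.Solver.+-*-Solver

  -- Naturals as rationals

  fromℕ : ℕ → ℚ
  fromℕ n = + n / 1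

  toℚᵘ-/ : ∀ n d → toℚᵘ (+ n / suc d) ℚᵘ.≃ mkℚᵘ (+ n) d
  toℚᵘ-/ n d = ℚ.toℚᵘ-fromℚᵘ (mkℚᵘ (+ n) d)

  fromℕ-+ : ∀ m n → fromℕ (m ℕ.+ n) ≡ fromℕ m + fromℕ n
  fromℕ-+ m n = ℚ.toℚᵘ-injective (begin-equality
    toℚᵘ (fromℕ (m ℕ.+ n))           ≃⟨ toℚᵘ-/ (m ℕ.+ n) 0 ⟩
    mkℚᵘ (+ (m ℕ.+ n)) 0             ≃⟨ *≡* (cong (ℤ._* + 1) (sym (cong₂ ℤ._+_ (ℤ.*-identityʳ (+ m)) (ℤ.*-identityʳ (+ n))))) ⟩
    mkℚᵘ (+ m) 0 ℚᵘ.+ mkℚᵘ (+ n) 0   ≃⟨ ℚᵘ.+-cong (ℚᵘ.≃-sym (toℚᵘ-/ m 0)) (ℚᵘ.≃-sym (toℚᵘ-/ n 0)) ⟩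
    toℚᵘ (fromℕ m) ℚᵘ.+ toℚᵘ (fromℕ n) ≃⟨ ℚᵘ.≃-sym (ℚ.toℚᵘ-homo-+ (fromℕ m) (fromℕ n)) ⟩
    toℚᵘ (fromℕ m + fromℕ n)         ∎)
    where
    open ℚᵘ.≤-Reasoning

  /≡fromℕ* : ∀ n d → + n / suc d ≡ fromℕ n * (+ 1 / suc d)
  /≡fromℕ* n d = ℚ.toℚᵘ-injective (begin-equality
    toℚᵘ (+ n / suc d)                      ≃⟨ toℚᵘ-/ n d ⟩
    mkℚᵘ (+ n) d                            ≃⟨ *≡* (cong₂ ℤ._*_ (sym (ℤ.*-identityʳ (+ n))) (cong (λ k → + suc k) (ℕ.+-identityʳ d))) ⟩
    mkℚᵘ (+ n) 0 ℚᵘ.* mkℚᵘ (+ 1) d          ≃⟨ ℚᵘ.*-cong (ℚᵘ.≃-sym (toℚᵘ-/ n 0)) (ℚᵘ.≃-sym (toℚᵘ-/ 1 d)) ⟩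
    toℚᵘ (fromℕ n) ℚᵘ.* toℚᵘ (+ 1 / suc d)  ≃⟨ ℚᵘ.≃-sym (ℚ.toℚᵘ-homo-* (fromℕ n) (+ 1 / suc d)) ⟩
    toℚᵘ (fromℕ n * (+ 1 / suc d))          ∎)
    where
    open ℚᵘ.≤-Reasoning

  p≤p+q : ∀ p {q} → 0ℚ ≤ q → p ≤ p + q
  p≤p+q p 0≤q = subst (_≤ p + _) (ℚ.+-identityʳ p) (ℚ.+-monoʳ-≤ p 0≤q)

  0≤fromℕ : ∀ n → 0ℚ ≤ fromℕ n
  0≤fromℕ n = ℚ.nonNegative⁻¹ (fromℕ n) {{ℚ.normalize-nonNeg n 1}}

  fromℕ-mono-≤ : ∀ {m n} → m ℕ.≤ n → fromℕ m ≤ fromℕ n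
  fromℕ-mono-≤ {m} {n} m≤n = subst (fromℕ m ≤_) (trans (sym (fromℕ-+ m (n ℕ.∸ m))) (cong fromℕ (ℕ.m+[n∸m]≡n m≤n)))
    (p≤p+q (fromℕ m) (0≤fromℕ (n ℕ.∸ m)))

  -- Binary expansions

  frac : ∀ {n} → Vec Bool n → ℚ
  frac []      = 0ℚ
  frac (b ∷ x) = ½ * (bit→ℚ b + frac x)

  *-ℚsum : ∀ {n} p (f : Fin n → ℚ) → p * ℚsum f ≡ ℚsum (λ i → p * f i)
  *-ℚsum {zero}  p f = ℚ.*-zeroʳ p
  *-ℚsum {suc n} p f = trans (ℚ.*-distribˡ-+ p (f Fin.zero) (ℚsum (f ∘ Fin.suc))) (cong (λ q → p * f Fin.zero + q) (*-ℚsum p (f ∘ Fin.suc)))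

  ℚsum-cong : ∀ {n} {f g : Fin n → ℚ} → f ≗ g → ℚsum f ≡ ℚsum g
  ℚsum-cong {zero}  f≗g = refl
  ℚsum-cong {suc n} f≗g = cong₂ _+_ (f≗g Fin.zero) (ℚsum-cong (f≗g ∘ Fin.suc))

  ℚsum≡frac : ∀ {n} (f : Fin n → Bool) → ℚsum (λ k → bit→ℚ (f k) * half^ (suc (toℕ k))) ≡ frac (tabulate f)
  ℚsum≡frac {zero}  f = refl
  ℚsum≡frac {suc n} f = begin
    b * (½ * 1ℚ) + ℚsum (λ k → bit→ℚ (f′ k) * (½ * half^ (suc (toℕ k))))
      ≡⟨ cong (λ q → b * (½ * 1ℚ) + q) (ℚsum-cong (λ k → solve 3 (λ x h y → x :* (h :* y) := h :* (x :* y)) refl (bit→ℚ (f′ k)) ½ (half^ (suc (toℕ k))))) ⟩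
    b * (½ * 1ℚ) + ℚsum (λ k → ½ * (bit→ℚ (f′ k) * half^ (suc (toℕ k))))
      ≡⟨ cong (λ q → b * (½ * 1ℚ) + q) (sym (*-ℚsum ½ (λ k → bit→ℚ (f′ k) * half^ (suc (toℕ k))))) ⟩
    b * (½ * 1ℚ) + ½ * s   ≡⟨ solve 3 (λ b h s → b :* (h :* con 1ℚ) :+ h :* s := h :* (b :+ s)) refl b ½ s ⟩
    ½ * (b + s)            ≡⟨ cong (λ t → ½ * (b + t)) (ℚsum≡frac f′) ⟩
    ½ * (b + frac (tabulate f′)) ∎
    where
    open ≡-Reasoning
    open +-*-Solver
    f′ = f ∘ Fin.suc
    b = bit→ℚ (f Fin.zero)
    s = ℚsum (λ k → bit→ℚ (f′ k) * half^ (suc (toℕ k)))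

  ½*-mono-< : ∀ {p q} → p < q → ½ * p < ½ * q
  ½*-mono-< = ℚ.*-monoʳ-<-pos ½

  ½*-cancel-< : ∀ {p q} → ½ * p < ½ * q → p < q
  ½*-cancel-< = ℚ.*-cancelˡ-<-nonNeg ½

  0≤bit : ∀ b → 0ℚ ≤ bit→ℚ b
  0≤bit false = ℚ.≤-refl
  0≤bit true  = ℚ.nonNegative⁻¹ 1ℚ

  bit≤1 : ∀ b → bit→ℚ b ≤ 1ℚ
  bit≤1 false = ℚ.nonNegative⁻¹ 1ℚ
  bit≤1 true  = ℚ.≤-refl

  0≤frac : ∀ {n} (x : Vec Bool n) → 0ℚ ≤ frac x
  0≤frac []      = ℚ.≤-refl
  0≤frac (b ∷ x) = subst (_≤ frac (b ∷ x)) (ℚ.*-zeroʳ ½) (ℚ.*-monoˡ-≤-nonNeg ½ (ℚ.+-mono-≤ (0≤bit b) (0≤frac x)))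

  frac<1 : ∀ {n} (x : Vec Bool n) → frac x < 1ℚ
  frac<1 []      = ℚ.positive⁻¹ 1ℚ
  frac<1 (b ∷ x) = ½*-mono-< {q = 1ℚ + 1ℚ} (ℚ.+-mono-≤-< (bit≤1 b) (frac<1 x))

  +-cancelˡ-< : ∀ p {q r} → p + q < p + r → q < r
  +-cancelˡ-< p lt = ℚ.≰⇒> (λ r≤q → ℚ.<-irrefl refl (ℚ.<-≤-trans lt (ℚ.+-monoʳ-≤ p r≤q)))

  lexLt : ∀ {n} → Vec Bool n → Vec Bool n → Bool
  lexLt []          []          = false
  lexLt (false ∷ x) (false ∷ a) = lexLt x a
  lexLt (false ∷ x) (true ∷ a)  = true
  lexLt (true ∷ x)  (false ∷ a) = false
  lexLt (true ∷ x)  (true ∷ a)  = lexLt x a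

  Reflects-map : ∀ {A B : Set} {b} → (A → B) → (B → A) → Reflects A b → Reflects B b
  Reflects-map f g (ofʸ a)  = ofʸ (f a)
  Reflects-map f g (ofⁿ ¬a) = ofⁿ (¬a ∘ g)

  frac-∷-reflects : ∀ {m n} b (x : Vec Bool m) (a : Vec Bool n) {r} → Reflects (frac x < frac a) r → Reflects (frac (b ∷ x) < frac (b ∷ a)) r
  frac-∷-reflects b x a = Reflects-map
    (½*-mono-< ∘ ℚ.+-monoʳ-< (bit→ℚ b))
    (λ lt → +-cancelˡ-< (bit→ℚ b) (½*-cancel-< lt))

  -- The first differing digit decides, because the digits after it amount to less than one unit of
  -- that digit.
  lexLt-reflects : ∀ {n} (x a : Vec Bool n) → Reflects (frac x < frac a) (lexLt x a)
  lexLt-reflects []          []          = ofⁿ (ℚ.<-irrefl refl)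
  lexLt-reflects (false ∷ x) (false ∷ a) = frac-∷-reflects false x a (lexLt-reflects x a)
  lexLt-reflects (true ∷ x)  (true ∷ a)  = frac-∷-reflects true x a (lexLt-reflects x a)
  lexLt-reflects (false ∷ x) (true ∷ a)  = ofʸ (½*-mono-< (ℚ.<-≤-trans
    (subst (_< 1ℚ) (sym (ℚ.+-identityˡ (frac x))) (frac<1 x)) (p≤p+q 1ℚ (0≤frac a))))
  lexLt-reflects (true ∷ x)  (false ∷ a) = ofⁿ (ℚ.<-asym (½*-mono-< (ℚ.<-≤-trans
    (subst (_< 1ℚ) (sym (ℚ.+-identityˡ (frac a))) (frac<1 a)) (p≤p+q 1ℚ (0≤frac x)))))

  ⅓ ⅔ : ℚ
  ⅓ = + 1 / 3
  ⅔ = + 2 / 3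

  -- The recursion rests on 2/3 = (1 + 1/3)/2 and 1/3 = (0 + 2/3)/2. When the digits run out, the
  -- remaining value 0 is below either threshold, whence the default `true` of `ltAlt`.
  ltAlt-reflects : ∀ {n} b (x : Vec Bool n) → Reflects (frac x < (if b then ⅔ else ⅓)) (ltAlt b n (stream x))
  ltAlt-reflects true  []          = ofʸ (ℚ.positive⁻¹ ⅔)
  ltAlt-reflects false []          = ofʸ (ℚ.positive⁻¹ ⅓)
  ltAlt-reflects true  (false ∷ x) = ofʸ (½*-mono-< {q = 1ℚ + ⅓} (ℚ.<-≤-trans
    (subst (_< 1ℚ) (sym (ℚ.+-identityˡ (frac x))) (frac<1 x)) (p≤p+q 1ℚ (ℚ.nonNegative⁻¹ ⅓))))
  ltAlt-reflects true  (true ∷ x)  = Reflects-map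
    (½*-mono-< {q = 1ℚ + ⅓} ∘ ℚ.+-monoʳ-< 1ℚ)
    (λ lt → +-cancelˡ-< 1ℚ (½*-cancel-< {q = 1ℚ + ⅓} lt))
    (ltAlt-reflects false x)
  ltAlt-reflects false (true ∷ x)  = ofⁿ (ℚ.<-asym (ℚ.<-≤-trans
    (½*-mono-< {⅔} {1ℚ} (from-yes (⅔ <? 1ℚ))) (ℚ.*-monoˡ-≤-nonNeg ½ (p≤p+q 1ℚ (0≤frac x)))))
  ltAlt-reflects false (false ∷ x) = Reflects-map
    (λ lt → ½*-mono-< {q = ⅔} (subst (_< ⅔) (sym (ℚ.+-identityˡ (frac x))) lt))
    (λ lt → subst (_< ⅔) (ℚ.+-identityˡ (frac x)) (½*-cancel-< {q = ⅔} lt))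
    (ltAlt-reflects true x)

  -- Admissible boxes have positive sides, so the abscissa 0 must be set apart.
  zero-or-positive : ∀ {n} (a : Vec Bool n) → (0ℚ < frac a) ⊎ ((∀ G → below a G ≡ 0) × val a ≡ 0)
  zero-or-positive []          = inj₂ ((λ _ → refl) , refl)
  zero-or-positive (true ∷ a)  = inj₁ (½*-mono-< {0ℚ} (ℚ.<-≤-trans (ℚ.positive⁻¹ 1ℚ) (p≤p+q 1ℚ (0≤frac a))))
  zero-or-positive (false ∷ a) with zero-or-positive a
  ... | inj₁ 0<a       = inj₁ (½*-mono-< {0ℚ} (subst (0ℚ <_) (sym (ℚ.+-identityˡ (frac a))) 0<a))
  ... | inj₂ (b≡0 , v≡0) = inj₂ ((λ G → b≡0 (G ∘ (false ∷_))) , v≡0)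

  2^*frac : ∀ {n} (a : Vec Bool n) → fromℕ (2 ℕ.^ n) * frac a ≡ fromℕ (val a)
  2^*frac []              = refl
  2^*frac {suc n} (b ∷ a) = begin
    fromℕ (2 ℕ.^ suc n) * (½ * (bit→ℚ b + frac a))
      ≡⟨ cong (_* (½ * (bit→ℚ b + frac a))) (trans (cong (λ k → fromℕ (2 ℕ.^ n ℕ.+ k)) (ℕ.+-identityʳ (2 ℕ.^ n))) (fromℕ-+ (2 ℕ.^ n) (2 ℕ.^ n))) ⟩
    (P + P) * (½ * (bit→ℚ b + frac a))
      ≡⟨ solve 3 (λ p b x → (p :+ p) :* (con ½ :* (b :+ x)) := b :* p :+ p :* x) refl P (bit→ℚ b) (frac a) ⟩
    bit→ℚ b * P + P * frac a
      ≡⟨ cong₂ _+_ (bit-* b) (2^*frac a) ⟩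
    fromℕ (ind b ℕ.* 2 ℕ.^ n) + fromℕ (val a)
      ≡⟨ sym (fromℕ-+ (ind b ℕ.* 2 ℕ.^ n) (val a)) ⟩
    fromℕ (val (b ∷ a)) ∎
    where
    open ≡-Reasoning
    open +-*-Solver
    P = fromℕ (2 ℕ.^ n)
    bit-* : ∀ b → bit→ℚ b * P ≡ fromℕ (ind b ℕ.* 2 ℕ.^ n)
    bit-* false = ℚ.*-zeroˡ P
    bit-* true  = trans (ℚ.*-identityˡ P) (cong fromℕ (sym (ℕ.*-identityˡ (2 ℕ.^ n))))

  -- Counting the points of the net

  sumN : ℕ → (ℕ → ℕ) → ℕ
  sumN zero    f = 0
  sumN (suc n) f = f 0 ℕ.+ sumN n (f ∘ suc)

  sumN-cong : ∀ n {f g : ℕ → ℕ} → f ≗ g → sumN n f ≡ sumN n g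
  sumN-cong zero    f≗g = refl
  sumN-cong (suc n) f≗g = cong₂ ℕ._+_ (f≗g 0) (sumN-cong n (f≗g ∘ suc))

  sumN-double : ∀ n f → sumN (n ℕ.* 2) f ≡ sumN n (λ i → f (i ℕ.* 2)) ℕ.+ sumN n (λ i → f (suc (i ℕ.* 2)))
  sumN-double zero    f = refl
  sumN-double (suc n) f = trans (cong (λ s → f 0 ℕ.+ (f 1 ℕ.+ s)) (sumN-double n (f ∘ suc ∘ suc)))
    (solve 4 (λ a b x y → a :+ (b :+ (x :+ y)) := (a :+ x) :+ (b :+ y)) refl (f 0) (f 1)
      (sumN n (λ i → f (suc (suc (i ℕ.* 2))))) (sumN n (λ i → f (suc (suc (suc (i ℕ.* 2)))))))
    where
    open ℕSolver

  -- The least significant digit of `n` comes first: as the first matrix is the identity, it is the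
  -- leading digit of the first coordinate.
  digits : ∀ m → ℕ → Vec Bool m
  digits m n = tabulate (digit n ∘ toℕ)

  digits-even : ∀ m n → digits (suc m) (n ℕ.* 2) ≡ false ∷ digits m n
  digits-even m n = cong₂ (λ r q → (r ℕ.≡ᵇ 1) ∷ digits m q) (ℕ.m*n%n≡0 n 2) (ℕ.m*n/n≡m n 2)

  digits-odd : ∀ m n → digits (suc m) (suc (n ℕ.* 2)) ≡ true ∷ digits m n
  digits-odd m n = cong₂ (λ r q → (r ℕ.≡ᵇ 1) ∷ digits m q) (ℕ.[m+kn]%n≡m%n 1 n 2)
    (trans (ℕ.+-distrib-/-∣ʳ 1 (n∣m*n n {2})) (ℕ.m*n/n≡m n 2))

  -- Even and odd `n` correspond to the two values of the first digit.
  sumN-digits : ∀ m (F : Vec Bool m → ℕ) → sumN (2 ℕ.^ m) (F ∘ digits m) ≡ sumV F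
  sumN-digits zero    F = ℕ.+-identityʳ (F [])
  sumN-digits (suc m) F = begin
    sumN (2 ℕ.* 2 ℕ.^ m) (F ∘ digits (suc m))
      ≡⟨ cong (λ n → sumN n (F ∘ digits (suc m))) (ℕ.*-comm 2 (2 ℕ.^ m)) ⟩
    sumN (2 ℕ.^ m ℕ.* 2) (F ∘ digits (suc m))
      ≡⟨ sumN-double (2 ℕ.^ m) (F ∘ digits (suc m)) ⟩
    sumN (2 ℕ.^ m) (λ n → F (digits (suc m) (n ℕ.* 2))) ℕ.+ sumN (2 ℕ.^ m) (λ n → F (digits (suc m) (suc (n ℕ.* 2))))
      ≡⟨ cong₂ ℕ._+_ (sumN-cong (2 ℕ.^ m) (λ n → cong F (digits-even m n))) (sumN-cong (2 ℕ.^ m) (λ n → cong F (digits-odd m n))) ⟩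
    sumN (2 ℕ.^ m) (F ∘ (false ∷_) ∘ digits m) ℕ.+ sumN (2 ℕ.^ m) (F ∘ (true ∷_) ∘ digits m)
      ≡⟨ cong₂ ℕ._+_ (sumN-digits m (F ∘ (false ∷_))) (sumN-digits m (F ∘ (true ∷_))) ⟩
    sumV F ∎
    where
    open ≡-Reasoning

  -- A general `g` is allowed because the induction shifts the index.
  count-map : ∀ {α β} {f : ℕ → ℚ × ℚ} {b c : ℕ → Bool} →
              (∀ n → Reflects (proj₁ (f n) < α) (b n)) → (∀ n → Reflects (proj₂ (f n) < β) (c n)) →
              ∀ g N → count α β (map f (applyUpTo g N)) ≡ sumN N (λ n → ind (b (g n) ∧ c (g n)))
  count-map rb rc g zero = refl
  count-map {α} {β} {f} {b} {c} rb rc g (suc N)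
    with proj₁ (f (g 0)) <? α | proj₂ (f (g 0)) <? β | b (g 0) | rb (g 0) | c (g 0) | rc (g 0)
  ... | yes _ | yes _ | _ | ofʸ _  | _ | ofʸ _  = cong suc (count-map rb rc (g ∘ suc) N)
  ... | yes _ | no _  | _ | ofʸ _  | _ | ofⁿ _  = count-map rb rc (g ∘ suc) N
  ... | no _  | _     | _ | ofⁿ _  | _ | _      = count-map rb rc (g ∘ suc) N
  ... | yes p | _     | _ | ofⁿ ¬p | _ | _      = contradiction p ¬p
  ... | no ¬p | _     | _ | ofʸ p  | _ | _      = contradiction p ¬p
  ... | yes _ | yes q | _ | ofʸ _  | _ | ofⁿ ¬q = contradiction q ¬q
  ... | yes _ | no ¬q | _ | ofʸ _  | _ | ofʸ q  = contradiction q ¬q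

  sumV-lexLt : ∀ {n} (a : Vec Bool n) (c : Vec Bool n → Bool) → sumV (λ x → ind (lexLt x a ∧ c x)) ≡ below a (ind ∘ c)
  sumV-lexLt []          c = refl
  sumV-lexLt {suc n} (false ∷ a) c = trans (cong₂ ℕ._+_ (sumV-lexLt a (c ∘ (false ∷_))) (sumV-0 n)) (ℕ.+-identityʳ _)
  sumV-lexLt (true ∷ a)  c = cong (sumV (ind ∘ c ∘ (false ∷_)) ℕ.+_) (sumV-lexLt a (c ∘ (true ∷_)))

  count-digitalNet : ∀ {m} (C : Mat m m) (a : Vec Bool m) →
    count (frac a) ⅔ (digitalNet (idMat m) C) ≡ below a (λ x → ind (ltAlt true m (image C x)))
  count-digitalNet {m} C a = begin
    count (frac a) ⅔ (digitalNet (idMat m) C)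
      ≡⟨ count-map reflects-x reflects-y id (2 ℕ.^ m) ⟩
    sumN (2 ℕ.^ m) ((λ x → ind (lexLt x a ∧ ltAlt true m (image C x))) ∘ digits m)
      ≡⟨ sumN-digits m (λ x → ind (lexLt x a ∧ ltAlt true m (image C x))) ⟩
    sumV (λ x → ind (lexLt x a ∧ ltAlt true m (image C x)))
      ≡⟨ sumV-lexLt a (λ x → ltAlt true m (image C x)) ⟩
    below a (λ x → ind (ltAlt true m (image C x))) ∎
    where
    open ≡-Reasoning
    coord-x : ∀ n → coord (idMat m) n ≡ frac (digits m n)
    coord-x n = trans (ℚsum≡frac (yDigit (idMat m) n)) (cong frac (Vec.tabulate-cong (apply-idMat {m} (digit n ∘ toℕ))))
    coord-y : ∀ n → coord C n ≡ frac (tabulate (apply C (lookup (digits m n))))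
    coord-y n = trans (ℚsum≡frac (yDigit C n))
      (cong frac (Vec.tabulate-cong (apply-cong C (λ i → sym (Vec.lookup∘tabulate (digit n ∘ toℕ) i)))))
    reflects-x : ∀ n → Reflects (coord (idMat m) n < frac a) (lexLt (digits m n) a)
    reflects-x n = subst (λ p → Reflects (p < frac a) (lexLt (digits m n) a)) (sym (coord-x n)) (lexLt-reflects (digits m n) a)
    reflects-y : ∀ n → Reflects (coord C n < ⅔) (ltAlt true m (image C (digits m n)))
    reflects-y n = subst (λ p → Reflects (p < ⅔) (ltAlt true m (image C (digits m n)))) (sym (coord-y n)) (ltAlt-reflects true (tabulate (apply C (lookup (digits m n)))))

  -- From counts to discrepancies

  -- The signed discrepancy of `[0, frac a) × [0, ⅔)`, with `val a` standing for `2 ^ m` times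
  -- `frac a`.
  excess : ∀ {m} → Mat m m → Vec Bool m → ℚ
  excess {m} C a = fromℕ (below a (λ x → ind (ltAlt true m (image C x)))) - fromℕ (val a) * ⅔

  localDisc-⅔ : ∀ {m} (C : Mat m m) a → localDisc (digitalNet (idMat m) C) (frac a) ⅔ ≡ ∣ excess C a ∣
  localDisc-⅔ {m} C a = cong ∣_∣ (cong₂ (λ A V → fromℕ A - V) (count-digitalNet C a)
    (trans (cong (λ N → fromℕ N * (frac a * ⅔)) (trans (List.length-map _ (upTo (2 ℕ.^ m))) (List.length-upTo (2 ℕ.^ m))))
      (trans (sym (ℚ.*-assoc (fromℕ (2 ℕ.^ m)) (frac a) ⅔)) (cong (_* ⅔) (2^*frac a)))))

  0≤localDisc : ∀ P α β → 0ℚ ≤ localDisc P α β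
  0≤localDisc P α β = ℚ.0≤∣p∣ (fromℕ (count α β P) - fromℕ (List.length P) * (α * β))

  p-ε<p : ∀ p {ε} → 0ℚ < ε → p - ε < p
  p-ε<p p {ε} 0<ε = subst (p - ε <_) (ℚ.+-identityʳ p) (ℚ.+-monoʳ-< p (ℚ.neg-antimono-< 0<ε))

  excess≡0 : ∀ {m} (C : Mat m m) a → (∀ G → below a G ≡ 0) × val a ≡ 0 → ∣ excess C a ∣ ≡ 0ℚ
  excess≡0 {m} C a (below≡0 , val≡0) = cong₂ (λ A V → ∣ fromℕ A - fromℕ V * ⅔ ∣)
    (below≡0 (λ x → ind (ltAlt true m (image C x)))) val≡0

  excess⇒StarDisc≥ : ∀ {m} (C : Mat m m) a K → K ≤ ∣ excess C a ∣ → StarDisc≥ (digitalNet (idMat m) C) K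
  excess⇒StarDisc≥ {m} C a K K≤ ε 0<ε = [ proper-box , unit-box ]′ (zero-or-positive a)
    where
    P = digitalNet (idMat m) C
    Box = ∃[ α₁ ] ∃[ α₂ ] ((0ℚ < α₁) × (α₁ ≤ 1ℚ) × (0ℚ < α₂) × (α₂ ≤ 1ℚ) × (K - ε < localDisc P α₁ α₂))
    proper-box : 0ℚ < frac a → Box
    proper-box 0<a = frac a , ⅔ , 0<a , ℚ.<⇒≤ (frac<1 a) , ℚ.positive⁻¹ ⅔ , from-yes (⅔ ℚ.≤? 1ℚ) ,
      ℚ.<-≤-trans (p-ε<p K 0<ε) (ℚ.≤-trans K≤ (ℚ.≤-reflexive (sym (localDisc-⅔ C a))))
    -- A degenerate box has discrepancy 0, so in this case K ≤ 0 and any box will do.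
    unit-box : (∀ G → below a G ≡ 0) × val a ≡ 0 → Box
    unit-box a≡0 = 1ℚ , 1ℚ , ℚ.positive⁻¹ 1ℚ , ℚ.≤-refl , ℚ.positive⁻¹ 1ℚ , ℚ.≤-refl ,
      ℚ.<-≤-trans (p-ε<p K 0<ε) (ℚ.≤-trans K≤ (ℚ.≤-trans (ℚ.≤-reflexive (excess≡0 C a a≡0)) (0≤localDisc P 1ℚ 1ℚ)))

  -- The final estimate

  ⅙ 3ℚ : ℚ
  ⅙ = + 1 / 6
  3ℚ = + 3 / 1

  larger-summand : ∀ p q r → r + r ≤ p + q → r ≤ p ⊎ r ≤ q
  larger-summand p q r le with r ℚ.≤? p | r ℚ.≤? q
  ... | yes r≤p | _       = inj₁ r≤p
  ... | _       | yes r≤q = inj₂ r≤q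
  ... | no r≰p  | no r≰q  = contradiction (ℚ.≤-<-trans le (ℚ.+-mono-< (ℚ.≰⇒> r≰p) (ℚ.≰⇒> r≰q))) (ℚ.<-irrefl refl)

  p≤∣p∣ : ∀ p → p ≤ ∣ p ∣
  p≤∣p∣ p with ℚ.≤-total 0ℚ p
  ... | inj₁ 0≤p = ℚ.≤-reflexive (sym (ℚ.0≤p⇒∣p∣≡p 0≤p))
  ... | inj₂ p≤0 = ℚ.≤-trans p≤0 (ℚ.0≤∣p∣ p)

  fromℕ-3*+2* : ∀ b v → fromℕ (3 ℕ.* b ℕ.+ 2 ℕ.* v) ≡ 3ℚ * (fromℕ b + fromℕ v * ⅔)
  fromℕ-3*+2* b v = begin
    fromℕ (3 ℕ.* b ℕ.+ 2 ℕ.* v)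
      ≡⟨ cong fromℕ (ℕsolve 2 (λ b v → ℕcon 3 :*ℕ b :+ℕ ℕcon 2 :*ℕ v :=ℕ (b :+ℕ (b :+ℕ b)) :+ℕ (v :+ℕ v)) refl b v) ⟩
    fromℕ ((b ℕ.+ (b ℕ.+ b)) ℕ.+ (v ℕ.+ v))
      ≡⟨ fromℕ-+ (b ℕ.+ (b ℕ.+ b)) (v ℕ.+ v) ⟩
    fromℕ (b ℕ.+ (b ℕ.+ b)) + fromℕ (v ℕ.+ v)
      ≡⟨ cong₂ _+_ (trans (fromℕ-+ b (b ℕ.+ b)) (cong (λ p → fromℕ b + p) (fromℕ-+ b b))) (fromℕ-+ v v) ⟩
    (fromℕ b + (fromℕ b + fromℕ b)) + (fromℕ v + fromℕ v)
      ≡⟨ solve 2 (λ b v → (b :+ (b :+ b)) :+ (v :+ v) := con 3ℚ :* (b :+ v :* con ⅔)) refl (fromℕ b) (fromℕ v) ⟩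
    3ℚ * (fromℕ b + fromℕ v * ⅔) ∎
    where
    open ≡-Reasoning
    open +-*-Solver
    open ℕSolver using () renaming (solve to ℕsolve; con to ℕcon; _:*_ to _:*ℕ_; _:+_ to _:+ℕ_; _:=_ to _:=ℕ_)

  -- The identity of `opposite-abscissae` divided by 3. The difference `h / 3` is written as two
  -- sixths, ready for `larger-summand`.
  excess-difference : ∀ b v b′ v′ h → 3 ℕ.* b ℕ.+ 2 ℕ.* v′ ≡ 3 ℕ.* b′ ℕ.+ 2 ℕ.* v ℕ.+ h →
    (fromℕ b - fromℕ v * ⅔) - (fromℕ b′ - fromℕ v′ * ⅔) ≡ fromℕ h * ⅙ + fromℕ h * ⅙
  excess-difference b v b′ v′ h eq = begin
    (fromℕ b - fromℕ v * ⅔) - (fromℕ b′ - fromℕ v′ * ⅔)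
      ≡⟨ solve 5 (λ b v b′ v′ t → (b :- v :* t) :- (b′ :- v′ :* t) := (b :+ v′ :* t) :- (b′ :+ v :* t)) refl (fromℕ b) (fromℕ v) (fromℕ b′) (fromℕ v′) ⅔ ⟩
    x - y                          ≡⟨ cong (_- y) (sym (trans (sym (ℚ.*-assoc ⅓ 3ℚ x)) (ℚ.*-identityˡ x))) ⟩
    ⅓ * (3ℚ * x) - y               ≡⟨ cong (λ p → ⅓ * p - y) scaled ⟩
    ⅓ * (3ℚ * y + fromℕ h) - y     ≡⟨ solve 4 (λ p q y h → p :* (q :* y :+ h) :- y := (p :* q) :* y :- y :+ p :* h) refl ⅓ 3ℚ y (fromℕ h) ⟩
    1ℚ * y - y + ⅓ * fromℕ h       ≡⟨ solve 3 (λ y s h → con 1ℚ :* y :- y :+ (s :+ s) :* h := h :* s :+ h :* s) refl y ⅙ (fromℕ h) ⟩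
    fromℕ h * ⅙ + fromℕ h * ⅙      ∎
    where
    open ≡-Reasoning
    open +-*-Solver
    x = fromℕ b + fromℕ v′ * ⅔
    y = fromℕ b′ + fromℕ v * ⅔
    scaled : 3ℚ * (fromℕ b + fromℕ v′ * ⅔) ≡ 3ℚ * (fromℕ b′ + fromℕ v * ⅔) + fromℕ h
    scaled = trans (sym (fromℕ-3*+2* b v′)) (trans (cong fromℕ eq)
      (trans (fromℕ-+ (3 ℕ.* b′ ℕ.+ 2 ℕ.* v) h) (cong (_+ fromℕ h) (fromℕ-3*+2* b′ v))))

  large-excess : ∀ h e (C : Mat (h ℕ.+ (e ℕ.+ h)) (h ℕ.+ (e ℕ.+ h))) → IsDigital0m2Net (idMat _) C →
                 Nonsingular {h} (λ i j → C (i ↑ˡ (e ℕ.+ h)) (j ↑ˡ (e ℕ.+ h))) →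
                 ∃[ a ] fromℕ h * ⅙ ≤ ∣ excess C a ∣
  large-excess h e C net ns = choose (opposite-abscissae h e (image C) (net⇒Separating C net) (nonsingular⇒surjective C ns))
    where
    G : Vec Bool (h ℕ.+ (e ℕ.+ h)) → ℕ
    G x = ind (ltAlt true (h ℕ.+ (e ℕ.+ h)) (image C x))
    choose : (∃[ a ] ∃[ a′ ] 3 ℕ.* below a G ℕ.+ 2 ℕ.* val a′ ≡ 3 ℕ.* below a′ G ℕ.+ 2 ℕ.* val a ℕ.+ h) →
             ∃[ a ] fromℕ h * ⅙ ≤ ∣ excess C a ∣
    choose (a , a′ , eq) = [ (λ le → a , le) , (λ le → a′ , le) ]′ (larger-summand ∣ excess C a ∣ ∣ excess C a′ ∣ (fromℕ h * ⅙) sum-bound)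
      where
      open ℚ.≤-Reasoning
      sum-bound : fromℕ h * ⅙ + fromℕ h * ⅙ ≤ ∣ excess C a ∣ + ∣ excess C a′ ∣
      sum-bound = begin
        fromℕ h * ⅙ + fromℕ h * ⅙          ≡⟨ excess-difference (below a G) (val a) (below a′ G) (val a′) h eq ⟨
        excess C a - excess C a′           ≤⟨ p≤∣p∣ (excess C a - excess C a′) ⟩
        ∣ excess C a - excess C a′ ∣       ≤⟨ ℚ.∣p-q∣≤∣p∣+∣q∣ (excess C a) (excess C a′) ⟩
        ∣ excess C a ∣ + ∣ excess C a′ ∣   ∎

  Nonsingular-cong : ∀ {k} {M N : Mat k k} → (∀ i j → M i j ≡ N i j) → Nonsingular M → Nonsingular N
  Nonsingular-cong M≗N (M⁻¹ , right , left) = M⁻¹ ,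
    (λ i j → trans (⊕sum-cong (λ l → cong (_∧ M⁻¹ l j) (sym (M≗N i l)))) (right i j)) ,
    (λ i j → trans (⊕sum-cong (λ l → cong (M⁻¹ i l ∧_) (sym (M≗N l j)))) (left i j))

  -- The loss for odd `m`, where one sixth of the half `(m - 1) / 2` is exactly `m / 12 - 1 / 12`.
  c₀ : ℚ
  c₀ = - (+ 1 / 12)

  half-bound : ∀ h e → e ℕ.≤ 1 → + (h ℕ.+ (e ℕ.+ h)) / 12 + c₀ ≤ fromℕ h * ⅙
  half-bound h e e≤1 = begin
    + m / 12 + c₀                         ≡⟨ cong (_+ c₀) (/≡fromℕ* m 11) ⟩
    fromℕ m * (+ 1 / 12) + c₀             ≤⟨ ℚ.+-monoˡ-≤ c₀ (ℚ.*-monoʳ-≤-nonNeg (+ 1 / 12) (fromℕ-mono-≤ m≤)) ⟩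
    fromℕ (h ℕ.+ (1 ℕ.+ h)) * (+ 1 / 12) + c₀
      ≡⟨ cong (λ p → p * (+ 1 / 12) + c₀) (trans (fromℕ-+ h (1 ℕ.+ h)) (cong (λ p → fromℕ h + p) (fromℕ-+ 1 h))) ⟩
    (fromℕ h + (1ℚ + fromℕ h)) * (+ 1 / 12) + c₀
      ≡⟨ solve 2 (λ h d → (h :+ (con 1ℚ :+ h)) :* d :+ (:- d) := h :* (d :+ d)) refl (fromℕ h) (+ 1 / 12) ⟩
    fromℕ h * ⅙                                       ∎
    where
    open ℚ.≤-Reasoning
    open +-*-Solver
    m = h ℕ.+ (e ℕ.+ h)
    m≤ : m ℕ.≤ h ℕ.+ (1 ℕ.+ h)
    m≤ = ℕ.+-monoʳ-≤ h (ℕ.+-monoˡ-≤ h e≤1)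

  -- Keeping `m` as a variable with an equation allows `m / 2` and `m % 2` to be put for `h` and `e`
  -- without casting the indices of `C`.
  starDisc-bound : ∀ h e {m} → h ℕ.+ (e ℕ.+ h) ≡ m → e ℕ.≤ 1 → (h≤m : h ℕ.≤ m) (C : Mat m m) → IsDigital0m2Net (idMat m) C →
                   Nonsingular (λ i j → C (Fin.inject≤ i h≤m) (Fin.inject≤ j h≤m)) →
                   StarDisc≥ (digitalNet (idMat m) C) (+ m / 12 + c₀)
  starDisc-bound h e refl e≤1 h≤m C net ns = excess⇒StarDisc≥ C (proj₁ large) (+ (h ℕ.+ (e ℕ.+ h)) / 12 + c₀)
    (ℚ.≤-trans (half-bound h e e≤1) (proj₂ large))
    where
    inject≤≡↑ˡ : ∀ (i : Fin h) → Fin.inject≤ i h≤m ≡ i ↑ˡ (e ℕ.+ h)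
    inject≤≡↑ˡ i = Fin.toℕ-injective (trans (Fin.toℕ-inject≤ i h≤m) (sym (Fin.toℕ-↑ˡ i (e ℕ.+ h))))
    large : ∃[ a ] fromℕ h * ⅙ ≤ ∣ excess C a ∣
    large = large-excess h e C net (Nonsingular-cong (λ i j → cong₂ C (inject≤≡↑ˡ i) (inject≤≡↑ˡ j)) ns)

  halves : ∀ m → m ℕ./ 2 ℕ.+ (m % 2 ℕ.+ m ℕ./ 2) ≡ m
  halves m = trans (solve 2 (λ q r → q :+ (r :+ q) := r :+ q :* con 2) refl (m ℕ./ 2) (m % 2)) (sym (ℕ.m≡m%n+[m/n]*n m 2))
    where
    open ℕSolver

open import Data.Nat using (ℕ; _≤_)
open import Data.Integer using (+_)
open import Data.Rational using (ℚ; _+_; _/_)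

theorem18 : ∃[ c ] ∀ (m : ℕ) → 1 ≤ m → (C₂ : Mat m m) →
    IsDigital0m2Net (idMat m) C₂ →
    Nonsingular (upperLeft C₂) →
    StarDisc≥ (digitalNet (idMat m) C₂) ((+ m) / 12 + c)
theorem18 = BoxDiscrepancy.c₀ , λ m _ C₂ net ns →
  BoxDiscrepancy.starDisc-bound (m ℕ./ 2) (m % 2) (BoxDiscrepancy.halves m) (ℕ.s≤s⁻¹ (ℕ.m%n<n m 2)) (ℕ.m/n≤m m 2) C₂ net ns
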